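{- Let $\ell$ be a positive integer and suppose $2\ell=pq+r$ for positive integers $p,q$ and an integer $r$ with $p/2\le r\le 20$. Then for every $S\subseteq D_{8\ell+2}\setminus\{e\}$ with $|S|=8\ell$ such that the unique non-identity element of $D_{8\ell+2}$ not in $S$ has the same order as $u^{2\ell-p+1}$, the group $D_{8\ell+2}$ has an $S$-sequencing.
   Context: $D_{2m}=\langle u,v : u^m=e=v^2,\ vu=u^{m-1}v\rangle$ is the dihedral group of order $2m$. For $S\subseteq G\setminus\{e\}$ with $|S|=k$, an $S$-sequencing of $G$ is an ordering $(g_1,\dots,g_k)$ of the elements of $S$ such that the partial products $h_0=e$, $h_i=g_1\cdots g_i$ ($1\le i\le k$) are pairwise distinct. -}

module Defs where

open import Algebra.Bundles using (Group; AbelianGroup)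
open import Algebra.Morphism.Structures using (IsGroupHomomorphism)
import Algebra.Properties.AbelianGroup as AbelianGroupProperties
import Algebra.Properties.Group as GroupProperties
import Algebra.Properties.Monoid.Mult as Mult
open import Data.Bool.Base using (Bool; true; false; not; if_then_else_)
open import Data.Fin.Base using (Fin; toℕ)
open import Data.Fin.Properties using (toℕ-fromℕ<; toℕ-injective; toℕ<n)
open import Data.List.Base using (List)
import Data.List.Relation.Binary.Permutation.Setoid as Permutation
import Data.List.Relation.Unary.Unique.Setoid as Uniqueness
open import Data.List.Scans.Base using (scanl)
open import Data.Nat.Base as ℕ using (ℕ; zero; suc; NonZero)
open import Data.Nat.DivMod
  using (_%_; _/_; _mod_; m%n<n; m≡m%n+[m/n]*n; m%n%n≡m%n; %-distribˡ-+; m<n⇒m%n≡m; n%n≡0)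
import Data.Nat.Properties as ℕₚ
open import Data.Product.Base using (_×_; _,_; proj₁; proj₂; ∃-syntax)
open import Level using (Level; _⊔_; 0ℓ)
open import Relation.Binary.PropositionalEquality.Core
  using (_≡_; refl; sym; trans; cong; cong₂)
open import Relation.Binary.PropositionalEquality.Properties
  using (module ≡-Reasoning; isEquivalence)

private
  variable
    c ℓ : Level

infixr 8 pow

pow : (G : Group c ℓ) → Group.Carrier G → ℕ → Group.Carrier G
pow G x n = n M.× x
  where module M = Mult (Group.monoid G)

syntax pow G x n = x ^[ G ] n

module _ (G : Group c ℓ) where

  open Group G

  HasOrder : Carrier → ℕ → Set ℓ
  HasOrder x n =
    0 ℕ.< n × x ^[ G ] n ≈ ε × (∀ k → 0 ℕ.< k → x ^[ G ] k ≈ ε → n ℕ.≤ k)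

  SameOrder : Carrier → Carrier → Set ℓ
  SameOrder x y = ∃[ n ] HasOrder x n × HasOrder y n

-- A finite subset S of a group is represented by a repetition-free list of its
-- elements (Unique S); an ordering of S is then a permutation of that list.

module _ (G : Group c ℓ) where

  open Group G
  open Permutation setoid using (_↭_)
  open Uniqueness setoid using (Unique)

  -- ε , g₁ , g₁ ∙ g₂ , … , g₁ ∙ ⋯ ∙ gₖ
  partialProducts : List Carrier → List Carrier
  partialProducts = scanl _∙_ ε

  IsSequencing : List Carrier → List Carrier → Set (c ⊔ ℓ)
  IsSequencing S gs = gs ↭ S × Unique (partialProducts gs)

  HasSequencing : List Carrier → Set (c ⊔ ℓ)
  HasSequencing S = ∃[ gs ] IsSequencing S gs

module Cyclic (m : ℕ) .{{_ : NonZero m}} where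

  infixl 6 _⊕_

  0# : Fin m
  0# = 0 mod m

  _⊕_ : Fin m → Fin m → Fin m
  i ⊕ j = (toℕ i ℕ.+ toℕ j) mod m

  ⊖_ : Fin m → Fin m
  ⊖ i = (m ℕ.∸ toℕ i) mod m

  toℕ-mod : ∀ n → toℕ (n mod m) ≡ n % m
  toℕ-mod n = toℕ-fromℕ< (m%n<n n m)

  mod-toℕ : ∀ i → toℕ i mod m ≡ i
  mod-toℕ i = toℕ-injective (trans (toℕ-mod (toℕ i)) (m<n⇒m%n≡m (toℕ<n i)))

  %-absorbˡ : ∀ a b → (a % m ℕ.+ b) % m ≡ (a ℕ.+ b) % m
  %-absorbˡ a b = begin
    (a % m ℕ.+ b) % m              ≡⟨ %-distribˡ-+ (a % m) b m ⟩
    (a % m % m ℕ.+ b % m) % m      ≡⟨ cong (λ z → (z ℕ.+ b % m) % m) (m%n%n≡m%n a m) ⟩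
    (a % m ℕ.+ b % m) % m          ≡⟨ %-distribˡ-+ a b m ⟨
    (a ℕ.+ b) % m                  ∎
    where open ≡-Reasoning

  ⊕-comm : ∀ i j → i ⊕ j ≡ j ⊕ i
  ⊕-comm i j = cong (_mod m) (ℕₚ.+-comm (toℕ i) (toℕ j))

  mod-⊕ : ∀ a j → a mod m ⊕ j ≡ (a ℕ.+ toℕ j) mod m
  mod-⊕ a j = toℕ-injective (begin
    toℕ (a mod m ⊕ j)                ≡⟨ toℕ-mod _ ⟩
    (toℕ (a mod m) ℕ.+ toℕ j) % m    ≡⟨ cong (λ z → (z ℕ.+ toℕ j) % m) (toℕ-mod a) ⟩
    (a % m ℕ.+ toℕ j) % m            ≡⟨ %-absorbˡ a (toℕ j) ⟩
    (a ℕ.+ toℕ j) % m                ≡⟨ toℕ-mod _ ⟨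
    toℕ ((a ℕ.+ toℕ j) mod m)        ∎)
    where open ≡-Reasoning

  mod-⊕-mod : ∀ a b → a mod m ⊕ b mod m ≡ (a ℕ.+ b) mod m
  mod-⊕-mod a b = toℕ-injective (begin
    toℕ (a mod m ⊕ b mod m)                  ≡⟨ toℕ-mod _ ⟩
    (toℕ (a mod m) ℕ.+ toℕ (b mod m)) % m    ≡⟨ cong₂ (λ y z → (y ℕ.+ z) % m) (toℕ-mod a) (toℕ-mod b) ⟩
    (a % m ℕ.+ b % m) % m                    ≡⟨ %-distribˡ-+ a b m ⟨
    (a ℕ.+ b) % m                            ≡⟨ toℕ-mod _ ⟨
    toℕ ((a ℕ.+ b) mod m)                    ∎)
    where open ≡-Reasoning

  ⊕-assoc : ∀ i j k → (i ⊕ j) ⊕ k ≡ i ⊕ (j ⊕ k)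
  ⊕-assoc i j k = begin
    (i ⊕ j) ⊕ k                           ≡⟨ mod-⊕ _ k ⟩
    (toℕ i ℕ.+ toℕ j ℕ.+ toℕ k) mod m     ≡⟨ cong (_mod m) (trans (ℕₚ.+-assoc (toℕ i) _ _) (ℕₚ.+-comm (toℕ i) _)) ⟩
    (toℕ j ℕ.+ toℕ k ℕ.+ toℕ i) mod m     ≡⟨ mod-⊕ _ i ⟨
    (j ⊕ k) ⊕ i                           ≡⟨ ⊕-comm (j ⊕ k) i ⟩
    i ⊕ (j ⊕ k)                           ∎
    where open ≡-Reasoning

  ⊕-identityˡ : ∀ i → 0# ⊕ i ≡ i
  ⊕-identityˡ i = trans (mod-⊕ 0 i) (mod-toℕ i)

  toℕ-0# : toℕ 0# ≡ 0
  toℕ-0# = trans (toℕ-mod 0) (m<n⇒m%n≡m (ℕ.>-nonZero⁻¹ m))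

  m-mod : m mod m ≡ 0#
  m-mod = toℕ-injective (trans (toℕ-mod m) (trans (n%n≡0 m) (sym toℕ-0#)))

  ⊕-inverseˡ : ∀ i → ⊖ i ⊕ i ≡ 0#
  ⊕-inverseˡ i = begin
    ⊖ i ⊕ i                          ≡⟨ mod-⊕ _ i ⟩
    (m ℕ.∸ toℕ i ℕ.+ toℕ i) mod m    ≡⟨ cong (_mod m) (ℕₚ.m∸n+n≡m (ℕₚ.<⇒≤ (toℕ<n i))) ⟩
    m mod m                          ≡⟨ m-mod ⟩
    0#                               ∎
    where open ≡-Reasoning

  abelianGroup : AbelianGroup 0ℓ 0ℓ
  abelianGroup = record
    { Carrier = Fin m
    ; _≈_ = _≡_
    ; _∙_ = _⊕_
    ; ε   = 0#
    ; _⁻¹ = ⊖_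
    ; isAbelianGroup = record
      { isGroup = record
        { isMonoid = record
          { isSemigroup = record
            { isMagma = record { isEquivalence = isEquivalence ; ∙-cong = cong₂ _⊕_ }
            ; assoc = ⊕-assoc
            }
          ; identity = ⊕-identityˡ , λ i → trans (⊕-comm i 0#) (⊕-identityˡ i)
          }
        ; inverse = ⊕-inverseˡ , λ i → trans (⊕-comm i (⊖ i)) (⊕-inverseˡ i)
        ; ⁻¹-cong = cong ⊖_
        }
      ; comm = ⊕-comm
      }
    }

-- The dihedral group of order 2m. The pair (i , s) stands for uⁱ if s is false
-- and for uⁱv if s is true; the product is forced by v uʲ = u⁻ʲ v.

module _ (m : ℕ) .{{_ : NonZero m}} where

  open Cyclic m
  private
    module A = AbelianGroup abelianGroup
    module Aₚ = AbelianGroupProperties abelianGroup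

    D : Set
    D = Fin m × Bool

    infixl 7 _·_

    _·_ : D → D → D
    (i , false) · (j , t) = i ⊕ j   , t
    (i , true)  · (j , t) = i ⊕ ⊖ j , not t

    inv : D → D
    inv (i , false) = ⊖ i , false
    inv (i , true)  = i , true

    ·-assoc : ∀ x y z → (x · y) · z ≡ x · (y · z)
    ·-assoc (i , false) (j , false) (k , t) = cong (_, t) (⊕-assoc i j k)
    ·-assoc (i , false) (j , true)  (k , t) = cong (_, not t) (⊕-assoc i j (⊖ k))
    ·-assoc (i , true)  (j , false) (k , t) = cong (_, not t)
      (trans (⊕-assoc i (⊖ j) (⊖ k)) (cong (i ⊕_) (Aₚ.⁻¹-∙-comm j k)))
    ·-assoc (i , true)  (j , true)  (k , t) = cong₂ _,_
      (trans (⊕-assoc i (⊖ j) k) (cong (i ⊕_)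
        (trans (cong (⊖ j ⊕_) (sym (Aₚ.⁻¹-involutive k))) (Aₚ.⁻¹-∙-comm j (⊖ k)))))
      (not-not t)
      where
      not-not : ∀ t → t ≡ not (not t)
      not-not false = refl
      not-not true  = refl

    ·-identityˡ : ∀ x → (0# , false) · x ≡ x
    ·-identityˡ (i , s) = cong (_, s) (⊕-identityˡ i)

    ·-identityʳ : ∀ x → x · (0# , false) ≡ x
    ·-identityʳ (i , false) = cong (_, false) (A.identityʳ i)
    ·-identityʳ (i , true)  = cong (_, true)
      (trans (cong (i ⊕_) Aₚ.ε⁻¹≈ε) (A.identityʳ i))

    ·-inverseˡ : ∀ x → inv x · x ≡ (0# , false)
    ·-inverseˡ (i , false) = cong (_, false) (A.inverseˡ i)
    ·-inverseˡ (i , true)  = cong (_, false) (A.inverseʳ i)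

    ·-inverseʳ : ∀ x → x · inv x ≡ (0# , false)
    ·-inverseʳ (i , false) = cong (_, false) (A.inverseʳ i)
    ·-inverseʳ (i , true)  = cong (_, false) (A.inverseʳ i)

  Dihedral : Group 0ℓ 0ℓ
  Dihedral = record
    { Carrier = D
    ; _≈_ = _≡_
    ; _∙_ = _·_
    ; ε   = 0# , false
    ; _⁻¹ = inv
    ; isGroup = record
      { isMonoid = record
        { isSemigroup = record
          { isMagma = record { isEquivalence = isEquivalence ; ∙-cong = cong₂ _·_ }
          ; assoc = ·-assoc
          }
        ; identity = ·-identityˡ , ·-identityʳ
        }
      ; inverse = ·-inverseˡ , ·-inverseʳ
      ; ⁻¹-cong = cong inv
      }
    }

  u v : Group.Carrier Dihedral
  u = 1 mod m , false
  v = 0# , true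

DihedralRelations : (m : ℕ) (G : Group c ℓ) (a b : Group.Carrier G) → Set ℓ
DihedralRelations m G a b =
  a ^[ G ] m ≈ ε × b ∙ b ≈ ε × b ∙ a ≈ a ^[ G ] (m ℕ.∸ 1) ∙ b
  where open Group G

-- Dihedral m is the group presented by DihedralRelations: u and v satisfy them,
-- and are universal among such pairs.

module _ (m : ℕ) .{{_ : NonZero m}} where

  open Cyclic m
  private module D = Group (Dihedral m)

  u^n : ∀ n → u m ^[ Dihedral m ] n ≡ (n mod m , false)
  u^n zero    = refl
  u^n (suc n) = trans (cong (u m D.∙_) (u^n n)) (cong (_, false) (mod-⊕-mod 1 n))

  relations : DihedralRelations m (Dihedral m) (u m) (v m)
  relations = trans (u^n m) (cong (_, false) m-mod)
            , cong (_, false) (AbelianGroup.inverseʳ abelianGroup 0#)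
            , (begin
                v m D.∙ u m                                ≡⟨ cong (_, true) (⊕-identityˡ _) ⟩
                ⊖ (1 mod m) , true                         ≡⟨ cong (_, true) ⊖1 ⟨
                (m ℕ.∸ 1) mod m , true                     ≡⟨ cong (_, true) (trans (⊕-comm _ 0#) (⊕-identityˡ _)) ⟨
                ((m ℕ.∸ 1) mod m , false) D.∙ v m          ≡⟨ cong (D._∙ v m) (u^n (m ℕ.∸ 1)) ⟨
                u m ^[ Dihedral m ] (m ℕ.∸ 1) D.∙ v m       ∎)
    where
    open ≡-Reasoning
    ⊖1 : (m ℕ.∸ 1) mod m ≡ ⊖ (1 mod m)
    ⊖1 = GroupProperties.inverseˡ-unique (AbelianGroup.group abelianGroup) _ _
      (trans (mod-⊕-mod (m ℕ.∸ 1) 1) (trans (cong (_mod m)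
        (ℕₚ.m∸n+n≡m (ℕ.>-nonZero⁻¹ m))) m-mod))

  normalForm : ∀ i s → (i , s) ≡ u m ^[ Dihedral m ] (toℕ i) D.∙ (if s then v m else D.ε)
  normalForm i s = sym (trans
    (cong (D._∙ (if s then v m else D.ε)) (trans (u^n (toℕ i)) (cong (_, false) (mod-toℕ i))))
    (last s))
    where
    last : ∀ s → (i , false) D.∙ (if s then v m else D.ε) ≡ (i , s)
    last false = D.identityʳ (i , false)
    last true  = cong (_, true) (trans (⊕-comm i 0#) (⊕-identityˡ i))

  module Universal (G : Group c ℓ) (a b : Group.Carrier G)
                   (rels : DihedralRelations m G a b) where

    open Group G hiding (refl; sym; trans)
    private
      module G = Group G
      module Gₚ = GroupProperties G
      module M = Mult monoid
    open import Relation.Binary.Reasoning.Setoid setoid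

    private
      am≈ε = proj₁ rels
      bb≈ε = proj₁ (proj₂ rels)
      ba≈  = proj₂ (proj₂ rels)

      a^ : ℕ → Carrier
      a^ n = a ^[ G ] n

      b^ : Bool → Carrier
      b^ s = if s then b else ε

      ε^ : ∀ k → k M.× ε ≈ ε
      ε^ zero    = G.refl
      ε^ (suc k) = G.trans (identityˡ _) (ε^ k)

      a^-% : ∀ n → a^ (n % m) ≈ a^ n
      a^-% n = begin
        a^ (n % m)                        ≈⟨ identityʳ _ ⟨
        a^ (n % m) ∙ ε                    ≈⟨ ∙-congˡ (ε^ (n / m)) ⟨
        a^ (n % m) ∙ (n / m) M.× ε          ≈⟨ ∙-congˡ (M.×-congʳ (n / m) am≈ε) ⟨
        a^ (n % m) ∙ (n / m) M.× (m M.× a)    ≈⟨ ∙-congˡ (M.×-assocˡ a (n / m) m) ⟩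
        a^ (n % m) ∙ a^ (n / m ℕ.* m)     ≈⟨ M.×-homo-+ a (n % m) _ ⟨
        a^ (n % m ℕ.+ n / m ℕ.* m)        ≈⟨ M.×-congˡ (m≡m%n+[m/n]*n n m) ⟨
        a^ n                              ∎

      a^-mod : ∀ n → a^ (toℕ (n mod m)) ≈ a^ n
      a^-mod n = G.trans (M.×-congˡ (toℕ-mod n)) (a^-% n)

      a^-⊕ : ∀ i j → a^ (toℕ (i ⊕ j)) ≈ a^ (toℕ i) ∙ a^ (toℕ j)
      a^-⊕ i j = G.trans (a^-mod _) (M.×-homo-+ a (toℕ i) (toℕ j))

      a^-⊖ : ∀ j → a^ (toℕ (⊖ j)) ≈ a^ (toℕ j) ⁻¹
      a^-⊖ j = Gₚ.inverseˡ-unique _ _ (begin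
        a^ (toℕ (⊖ j)) ∙ a^ (toℕ j)   ≈⟨ a^-⊕ (⊖ j) j ⟨
        a^ (toℕ (⊖ j ⊕ j))            ≈⟨ M.×-congˡ (trans (cong toℕ (⊕-inverseˡ j)) toℕ-0#) ⟩
        ε                             ∎)

      ba : b ∙ a ≈ a ⁻¹ ∙ b
      ba = G.trans ba≈ (∙-congʳ (Gₚ.inverseˡ-unique _ _ (begin
        a^ (m ℕ.∸ 1) ∙ a         ≈⟨ ∙-congˡ (M.×-homo-1 a) ⟨
        a^ (m ℕ.∸ 1) ∙ a^ 1      ≈⟨ M.×-homo-+ a (m ℕ.∸ 1) 1 ⟨
        a^ (m ℕ.∸ 1 ℕ.+ 1)       ≈⟨ M.×-congˡ (ℕₚ.m∸n+n≡m (ℕ.>-nonZero⁻¹ m)) ⟩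
        a^ m                     ≈⟨ am≈ε ⟩
        ε                        ∎)))

      ba^ : ∀ n → b ∙ a^ n ≈ a^ n ⁻¹ ∙ b
      ba^ zero    = begin
        b ∙ ε       ≈⟨ identityʳ b ⟩
        b           ≈⟨ identityˡ b ⟨
        ε ∙ b       ≈⟨ ∙-congʳ Gₚ.ε⁻¹≈ε ⟨
        ε ⁻¹ ∙ b    ∎
      ba^ (suc n) = begin
        b ∙ a^ (suc n)                  ≈⟨ ∙-congˡ (M.×-congˡ (ℕₚ.+-comm 1 n)) ⟩
        b ∙ a^ (n ℕ.+ 1)                ≈⟨ ∙-congˡ (M.×-homo-+ a n 1) ⟩
        b ∙ (a^ n ∙ a^ 1)               ≈⟨ assoc _ _ _ ⟨
        b ∙ a^ n ∙ a^ 1                 ≈⟨ ∙-cong (ba^ n) (M.×-homo-1 a) ⟩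
        a^ n ⁻¹ ∙ b ∙ a                 ≈⟨ assoc _ _ _ ⟩
        a^ n ⁻¹ ∙ (b ∙ a)               ≈⟨ ∙-congˡ ba ⟩
        a^ n ⁻¹ ∙ (a ⁻¹ ∙ b)            ≈⟨ assoc _ _ _ ⟨
        a^ n ⁻¹ ∙ a ⁻¹ ∙ b              ≈⟨ ∙-congʳ (Gₚ.⁻¹-anti-homo-∙ a (a^ n)) ⟨
        a^ (suc n) ⁻¹ ∙ b               ∎

    hom : D.Carrier → Carrier
    hom (i , s) = a^ (toℕ i) ∙ b^ s

    hom-∙ : ∀ x y → hom (x D.∙ y) ≈ hom x ∙ hom y
    hom-∙ (i , false) (j , t) = begin
      a^ (toℕ (i ⊕ j)) ∙ b^ t                  ≈⟨ ∙-congʳ (a^-⊕ i j) ⟩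
      a^ (toℕ i) ∙ a^ (toℕ j) ∙ b^ t           ≈⟨ assoc _ _ _ ⟩
      a^ (toℕ i) ∙ (a^ (toℕ j) ∙ b^ t)         ≈⟨ ∙-congʳ (identityʳ _) ⟨
      a^ (toℕ i) ∙ ε ∙ (a^ (toℕ j) ∙ b^ t)     ∎
    hom-∙ (i , true) (j , t) = begin
      a^ (toℕ (i ⊕ ⊖ j)) ∙ b^ (not t)               ≈⟨ ∙-cong (a^-⊕ i (⊖ j)) (b^-not t) ⟩
      a^ (toℕ i) ∙ a^ (toℕ (⊖ j)) ∙ (b ∙ b^ t)      ≈⟨ ∙-congʳ (∙-congˡ (a^-⊖ j)) ⟩
      a^ (toℕ i) ∙ a^ (toℕ j) ⁻¹ ∙ (b ∙ b^ t)       ≈⟨ assoc _ _ _ ⟨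
      a^ (toℕ i) ∙ a^ (toℕ j) ⁻¹ ∙ b ∙ b^ t         ≈⟨ ∙-congʳ (assoc _ _ _) ⟩
      a^ (toℕ i) ∙ (a^ (toℕ j) ⁻¹ ∙ b) ∙ b^ t       ≈⟨ ∙-congʳ (∙-congˡ (ba^ (toℕ j))) ⟨
      a^ (toℕ i) ∙ (b ∙ a^ (toℕ j)) ∙ b^ t          ≈⟨ ∙-congʳ (assoc _ _ _) ⟨
      a^ (toℕ i) ∙ b ∙ a^ (toℕ j) ∙ b^ t            ≈⟨ assoc _ _ _ ⟩
      a^ (toℕ i) ∙ b ∙ (a^ (toℕ j) ∙ b^ t)          ∎
      where
      b^-not : ∀ t → b^ (not t) ≈ b ∙ b^ t
      b^-not false = G.sym (identityʳ b)
      b^-not true  = G.sym bb≈ε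

    hom-ε : hom D.ε ≈ ε
    hom-ε = G.trans (identityʳ _) (M.×-congˡ toℕ-0#)

    isGroupHomomorphism : IsGroupHomomorphism D.rawGroup rawGroup hom
    isGroupHomomorphism = record
      { isMonoidHomomorphism = record
        { isMagmaHomomorphism = record
          { isRelHomomorphism = record { cong = λ p → G.reflexive (cong hom p) }
          ; homo = hom-∙
          }
        ; ε-homo = hom-ε
        }
      ; ⁻¹-homo = λ x → Gₚ.inverseˡ-unique _ _ (begin
          hom (x D.⁻¹) ∙ hom x    ≈⟨ hom-∙ (x D.⁻¹) x ⟨
          hom (x D.⁻¹ D.∙ x)      ≈⟨ G.reflexive (cong hom (D.inverseˡ x)) ⟩
          hom D.ε                 ≈⟨ hom-ε ⟩
          ε                       ∎)
      }

    hom-u : hom (u m) ≈ a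
    hom-u = G.trans (identityʳ _) (G.trans (a^-mod 1) (M.×-homo-1 a))

    hom-v : hom (v m) ≈ b
    hom-v = G.trans (∙-congʳ (M.×-congˡ toℕ-0#)) (identityˡ b)

    hom-unique : ∀ {g} → IsGroupHomomorphism D.rawGroup rawGroup g →
                 g (u m) ≈ a → g (v m) ≈ b → ∀ x → g x ≈ hom x
    hom-unique {g} g-hom gu≈a gv≈b (i , s) = begin
      g (i , s)                                                  ≈⟨ H.⟦⟧-cong (normalForm i s) ⟩
      g (u m ^[ Dihedral m ] (toℕ i) D.∙ (if s then v m else D.ε))  ≈⟨ H.homo _ _ ⟩
      g (u m ^[ Dihedral m ] (toℕ i)) ∙ g (if s then v m else D.ε)  ≈⟨ ∙-cong (g-u^ (toℕ i)) (g-v^ s) ⟩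
      hom (i , s)                                                ∎
      where
      module H = IsGroupHomomorphism g-hom
      g-u^ : ∀ n → g (u m ^[ Dihedral m ] n) ≈ a^ n
      g-u^ zero    = H.ε-homo
      g-u^ (suc n) = G.trans (H.homo _ _) (∙-cong gu≈a (g-u^ n))
      g-v^ : ∀ s → g (if s then v m else D.ε) ≈ b^ s
      g-v^ false = H.ε-homo
      g-v^ true  = gv≈b

{-# OPTIONS --safe #-}
-- Let m = 4ℓ + 1 and N = 2ℓ. In the dihedral group the quotient g⁻¹h of two rotations or of two reflections is
-- the rotation by ± the difference of their indices, and the quotient of a rotation and a reflection, in either
-- order, is the reflection whose index is the difference of theirs. A sequencing amounts to a path g₀, g₁, … whose
-- consecutive quotients are the elements of S.
--
-- Take a graceful labelling w₁, …, w_N of a path by 1, …, N with w₁ ∈ {ℓ, ℓ + 1}, and walk along the rotations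
-- w_N, …, w₁, then zigzag between the rotations 0, -1, …, -N and the reflections 0, 1, …, N so that all reflections
-- occur as quotients, and then along the reflections -w₁, …, -w_N. Every difference ±d with 0 < d < N occurs, once
-- in each half, and the two remaining ones ±N occur where the three pieces are joined. This visits all of the group
-- and uses every nonidentity quotient, so dropping the last vertex drops just the quotient ±(w_N - w_{N-1}).
--
-- If w ends at the k-th place, k = ⌈p/2⌉, from an end of its interval, it can be prolonged by a zigzag of p new labels taken
-- from the two sides of the interval, and the result again ends at a k-th place; its last difference is N - p + 1. Hence
-- 2ℓ = pq + r reduces the problem to labellings of length r, which are tabulated. A labelling whose two ends are
-- forced to coincide does not exist; in these cases length p + r is tabulated instead, or, when q = 1, the order of
-- u^(2ℓ-p+1) is that of u^(2ℓ) or of u^(2ℓ-1), the cases p = 1 and p = 2. For p = 1 there is a variant in which the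
-- middle piece and w are plain zigzags and only the quotient -N is missed. Finally, elements of the same order in a
-- cyclic group are related by an automorphism, which extends to the dihedral group.
module Submission where

open import Defs
open import Algebra.Bundles using (Group)
import Algebra.Properties.AbelianGroup as AbelianGroupProperties
import Algebra.Properties.Group as GroupProperties
open import Data.Bool.Base using (true; false; not)
open import Data.Fin.Base using (Fin; toℕ)
open import Data.Fin.Properties using (toℕ<n; toℕ-injective)
open import Data.List.Base
  using (List; []; _∷_; _++_; _∷ʳ_; length; map; reverse; last; take; allFin)
open import Data.List.Membership.Propositional using (_∈_; _∉_)
open import Data.List.Membership.Propositional.Properties
  using (∈-++⁺ˡ; ∈-++⁺ʳ; ∈-map⁺; ∈-map⁻; ∈-∃++)
open import Data.List.Properties
  using (++-assoc; length-++; length-map; map-++; length-reverse; unfold-reverse; length-tabulate)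
open import Data.List.Relation.Binary.Permutation.Propositional
  using (_↭_; ↭-refl; ↭-prep; ↭-trans; ↭-sym; ↭⇒↭ₛ)
open import Data.List.Relation.Binary.Permutation.Propositional.Properties
  using (shift; ∈-resp-↭; ↭-length)
import Data.List.Relation.Binary.Permutation.Setoid.Properties as Permutationₛ
open import Data.List.Relation.Unary.All as All using (All; []; _∷_; all?)
import Data.List.Relation.Unary.All.Properties as Allₚ
open import Data.List.Relation.Unary.AllPairs using ([]; _∷_)
open import Data.List.Relation.Unary.Any as Any using (Any; here; there; any?)
import Data.List.Relation.Unary.Any.Properties as Anyₚ
open import Data.List.Relation.Unary.Unique.Propositional using (Unique)
import Data.List.Relation.Unary.Unique.Propositional.Properties as Uniqueₚ
open import Data.List.Scans.Base using (scanl)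
open import Data.Maybe.Base using (just)
import Data.Maybe.Properties as Maybe
open import Data.Nat.Base
open import Data.Nat.Coprimality as Coprimality
  using (Coprime; coprime-divisor; coprime⇒gcd≡1; gcd≡1⇒coprime)
open import Data.Nat.Divisibility
open import Data.Nat.DivMod
  using (_%_; _/_; _mod_; m≡m%n+[m/n]*n; [m+kn]%n≡m%n; m*n%n≡0)
open import Data.Nat.GCD
  using (gcd; gcd-GCD; gcd-greatest; gcd[m,n]∣m; gcd[m,n]∣n; module Bézout)
open import Data.Nat.Induction using (<-rec)
open import Data.Nat.Properties
open import Data.List.Membership.DecPropositional _≟_ using (_∈?_)
open import Data.Nat.Tactic.RingSolver using (solve-∀)
open import Data.Product.Base using (_×_; _,_; proj₁; proj₂; ∃; ∃₂)
open import Data.Sum.Base as Sum using (_⊎_; inj₁; inj₂; [_,_]′)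
open import Data.Empty using (⊥; ⊥-elim)
open import Relation.Binary.Definitions using (tri<; tri≈; tri>)
open import Relation.Binary.PropositionalEquality
open import Relation.Nullary using (Dec; yes; no; contradiction)
open import Relation.Nullary.Decidable using (from-yes; _×-dec_; _⊎-dec_; _→-dec_)
open import Relation.Unary using (Decidable)

-- Consecutive pairs of a list, and permutations by counting.

stepsFrom : ∀ {a b} {A : Set a} {B : Set b} → (A → A → B) → A → List A → List B
stepsFrom f x []       = []
stepsFrom f x (y ∷ ys) = f x y ∷ stepsFrom f y ys

steps : ∀ {a b} {A : Set a} {B : Set b} → (A → A → B) → List A → List B
steps f []       = []
steps f (x ∷ xs) = stepsFrom f x xs

data Adjacent {a} {A : Set a} (x y : A) : List A → Set a where
  here  : ∀ {l} → Adjacent x y (x ∷ y ∷ l)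
  there : ∀ {z l} → Adjacent x y l → Adjacent x y (z ∷ l)

module _ {a} {A : Set a} where

  adj-++ˡ : ∀ {x y : A} {l m} → Adjacent x y l → Adjacent x y (l ++ m)
  adj-++ˡ here      = here
  adj-++ˡ (there p) = there (adj-++ˡ p)

  adj-++ʳ : ∀ {x y : A} l {m} → Adjacent x y m → Adjacent x y (l ++ m)
  adj-++ʳ []      p = p
  adj-++ʳ (_ ∷ l) p = there (adj-++ʳ l p)

  adj-steps⁺ : ∀ {b} {B : Set b} (f : A → A → B) {x y l} → Adjacent x y l → f x y ∈ steps f l
  adj-steps⁺ f here              = here refl
  adj-steps⁺ f (there {l = _ ∷ _} p) = there (adj-steps⁺ f p)

  adj-steps⁻ : ∀ {b} {B : Set b} (f : A → A → B) {z} l → z ∈ steps f l →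
               ∃₂ λ x y → Adjacent x y l × f x y ≡ z
  adj-steps⁻ f (x ∷ y ∷ l) (here refl) = x , y , here , refl
  adj-steps⁻ f (x ∷ y ∷ l) (there p) with adj-steps⁻ f (y ∷ l) p
  ... | u , v , q , eq = u , v , there q , eq

adj-map : ∀ {a b} {A : Set a} {B : Set b} (f : A → B) {x y l} →
          Adjacent x y l → Adjacent (f x) (f y) (map f l)
adj-map f here      = here
adj-map f (there p) = there (adj-map f p)

adj-link : ∀ {a} {A : Set a} (l : List A) x y {m} → Adjacent x y (l ∷ʳ x ++ y ∷ m)
adj-link l x y {m} = subst (Adjacent x y) (sym (++-assoc l (x ∷ []) (y ∷ m))) (adj-++ʳ l here)

last⇒∷ʳ : ∀ {a} {A : Set a} (w : List A) {z} → last w ≡ just z → ∃ λ l → w ≡ l ∷ʳ z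
last⇒∷ʳ (x ∷ [])    refl = [] , refl
last⇒∷ʳ (x ∷ y ∷ w) eq   with last⇒∷ʳ (y ∷ w) eq
... | l , eq′ = x ∷ l , cong (x ∷_) eq′

module _ {a} {A : Set a} where

  -- Pigeonhole: the entries of `ys` are extracted from `xs` one by one, and equal lengths leave
  -- nothing over. That `xs` has no repetitions is then a consequence.
  unique-⊆⇒↭ : ∀ {xs ys : List A} → Unique ys → (∀ {z} → z ∈ ys → z ∈ xs) →
               length xs ≡ length ys → xs ↭ ys
  unique-⊆⇒↭ {[]} {[]}     u       ys⊆ eq = ↭-refl
  unique-⊆⇒↭ {xs} {y ∷ ys} (y∉ ∷ u) ys⊆ eq with ∈-∃++ (ys⊆ (here refl))
  ... | as , bs , refl = ↭-trans p (↭-prep y (unique-⊆⇒↭ u ys⊆′ (suc-injective (trans (sym (↭-length p)) eq))))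
    where
    p : as ++ y ∷ bs ↭ y ∷ as ++ bs
    p = shift y as bs
    ys⊆′ : ∀ {z} → z ∈ ys → z ∈ as ++ bs
    ys⊆′ z∈ with ∈-resp-↭ p (ys⊆ (there z∈))
    ... | here refl = contradiction refl (All.lookup y∉ z∈)
    ... | there z∈′ = z∈′

  unique-resp-↭ : ∀ {xs ys : List A} → xs ↭ ys → Unique xs → Unique ys
  unique-resp-↭ p = Permutationₛ.Unique-resp-↭ (setoid A) (↭⇒↭ₛ p)

  unique-++⁻ˡ : ∀ (xs : List A) {ys} → Unique (xs ++ ys) → Unique xs
  unique-++⁻ˡ []       u        = []
  unique-++⁻ˡ (x ∷ xs) (x∉ ∷ u) = Allₚ.++⁻ˡ xs x∉ ∷ unique-++⁻ˡ xs u

  adj-reverse : ∀ {x y : A} {l} → Adjacent x y l → Adjacent y x (reverse l)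
  adj-reverse {x} {y} (here {l}) = subst (Adjacent y x)
    (sym (trans (unfold-reverse x (y ∷ l)) (cong (_∷ʳ x) (unfold-reverse y l))))
    (adj-link (reverse l) y x)
  adj-reverse (there {z} {l} p) = subst (Adjacent _ _) (sym (unfold-reverse z l)) (adj-++ˡ (adj-reverse p))

  -- Serves to drop the last vertex of a tour: only the pair ending there can be lost.
  adj-init : ∀ {x y : A} l {u v} → Adjacent x y (l ++ u ∷ v ∷ []) →
             Adjacent x y (l ∷ʳ u) ⊎ (x ≡ u × y ≡ v)
  adj-init []          here      = inj₂ (refl , refl)
  adj-init []          (there (there ()))
  adj-init (x ∷ [])    here      = inj₁ here
  adj-init (x ∷ [])    (there p) = Sum.map₁ there (adj-init [] p)
  adj-init (x ∷ y ∷ l) here      = inj₁ here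
  adj-init (x ∷ y ∷ l) (there p) = Sum.map₁ there (adj-init (y ∷ l) p)

  length-steps : ∀ {b} {B : Set b} (f : A → A → B) l → length (steps f l) ≡ pred (length l)
  length-steps f []          = refl
  length-steps f (x ∷ [])    = refl
  length-steps f (x ∷ y ∷ l) = cong suc (length-steps f (y ∷ l))

-- Graceful labellings

-- Stated by existence alone: `n` labels have only n - 1 adjacent pairs, so by counting every label
-- and every jump occurs exactly once.
record Graceful (a n : ℕ) (w : List ℕ) : Set where
  field
    size   : length w ≡ n
    covers : ∀ {x} → a ≤ x → x < a + n → x ∈ w
    jumps  : ∀ {d} → 0 < d → d < n → ∃₂ λ x y → Adjacent x y w × ∣ x - y ∣ ≡ d

-- Zigzags through an interval.

data Side : Set where
  low high : Side

opp : Side → Side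
opp low  = high
opp high = low

-- The amount by which the lower end of the interval rises when a label is taken at this side.
bal : Side → ℕ
bal low  = 1
bal high = 0

first : Side → ℕ → ℕ → ℕ
first low  a n = a
first high a n = a + n

-- The extreme labels of the interval of `p + n` labels from `a` are taken alternately; the `n`
-- labels from `off τ p a` remain.
zig : Side → ℕ → ℕ → ℕ → List ℕ
zig τ zero    a n = []
zig τ (suc p) a n = first τ a (p + n) ∷ zig (opp τ) p (bal τ + a) n

off : Side → ℕ → ℕ → ℕ
off τ zero    a = a
off τ (suc p) a = off (opp τ) p (bal τ + a)

next : Side → ℕ → Side
next τ zero    = τ
next τ (suc p) = next (opp τ) p

lows : Side → ℕ → ℕ
lows τ zero    = 0
lows τ (suc p) = bal τ + lows (opp τ) p

off-lows : ∀ τ p a → off τ p a ≡ lows τ p + a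
off-lows τ zero    a = refl
off-lows τ (suc p) a = trans (off-lows (opp τ) p (bal τ + a))
  (trans (sym (+-assoc (lows (opp τ) p) (bal τ) a)) (cong (_+ a) (+-comm _ (bal τ))))

-- The sides alternate, so half of the labels taken are low; the two `bal` terms carry the parity
-- correction.
balance : ∀ τ p → lows τ p + lows τ p + bal (next τ p) ≡ p + bal τ
balance τ zero    = refl
balance low (suc p) = cong suc (trans (cong (_+ bal (next high p)) (+-suc (lows high p) _)) (trans (cong suc (balance high p)) (sym (+-suc p 0))))
balance high (suc p) = trans (balance low p) (+-suc p 0)

length-zig : ∀ τ p a n → length (zig τ p a n) ≡ p
length-zig τ zero    a n = refl
length-zig τ (suc p) a n = cong suc (length-zig (opp τ) p _ n)

zig-covers : ∀ τ p a n {x} → a ≤ x → x < a + (p + n) →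
             x ∈ zig τ p a n ⊎ (off τ p a ≤ x × x < off τ p a + n)
zig-covers τ    zero    a n a≤x x< = inj₂ (a≤x , x<)
zig-covers low  (suc p) a n {x} a≤x x< with m≤n⇒m<n∨m≡n a≤x
... | inj₂ a≡x = inj₁ (here (sym a≡x))
... | inj₁ a<x = Sum.map₁ there (zig-covers high p (suc a) n a<x (subst (x <_) (+-suc a (p + n)) x<))
zig-covers high (suc p) a n {x} a≤x x< with m≤n⇒m<n∨m≡n (s≤s⁻¹ (subst (x <_) (+-suc a (p + n)) x<))
... | inj₂ x≡ = inj₁ (here x≡)
... | inj₁ x<′ = Sum.map₁ there (zig-covers low p a n a≤x x<′)

-- `τ` is the side of the next label. The previous one, `x`, lies just beyond the opposite end, so
-- the next jump equals the number of labels left.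
Outside : Side → ℕ → ℕ → ℕ → Set
Outside low  x a n = x ≡ a + n
Outside high x a n = suc x ≡ a

outside-jump : ∀ τ {x a n} → Outside τ x a (suc n) → ∣ x - first τ a n ∣ ≡ suc n
outside-jump low  {a = a} {n} refl = trans (∣-∣-comm (a + suc n) a) (∣m-m+n∣≡n a (suc n))
outside-jump high {x} {n = n} refl = trans (cong (∣ x -_∣) (sym (+-suc x n))) (∣m-m+n∣≡n x (suc n))

outside-first : ∀ τ a n → Outside (opp τ) (first τ a n) (bal τ + a) n
outside-first low  a n = refl
outside-first high a n = refl

-- Each jump equals the number of labels still left, so the jumps run down from p + n to n + 1.
zig-jumps : ∀ τ p {x a n} → Outside τ x a (p + n) → ∀ {d} → n < d → d ≤ p + n →
            ∃₂ λ u v → Adjacent u v (x ∷ zig τ p a n) × ∣ u - v ∣ ≡ d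
zig-jumps τ zero    o n<d d≤ = ⊥-elim (<-irrefl refl (<-≤-trans n<d d≤))
zig-jumps τ (suc p) {x} {a} {n} o n<d d≤ with m≤n⇒m<n∨m≡n d≤
... | inj₂ refl = _ , _ , here , outside-jump τ o
... | inj₁ d<  with zig-jumps (opp τ) p (outside-first τ a (p + n)) n<d (s≤s⁻¹ d<)
...   | u , v , q , eq = u , v , there q , eq

zig-end : ∀ τ p {x a n} → Outside τ x a (p + n) →
          ∃₂ λ l z → x ∷ zig τ p a n ≡ l ∷ʳ z × Outside (next τ p) z (off τ p a) n
zig-end τ zero    o = [] , _ , refl , o
zig-end τ (suc p) {x} {a} {n} o with zig-end (opp τ) p (outside-first τ a (p + n))
... | l , z , eq , o′ = x ∷ l , z , cong (x ∷_) eq , o′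

zig-last : ∀ τ p {x a n} → Outside τ x a (suc p + n) →
           ∃ λ l → ∃₂ λ u v → x ∷ zig τ (suc p) a n ≡ l ++ u ∷ v ∷ [] × ∣ u - v ∣ ≡ suc n
zig-last τ zero    {x} o = [] , x , _ , refl , outside-jump τ o
zig-last τ (suc p) {x} {a} {n} o with zig-last (opp τ) p (outside-first τ a (suc p + n))
... | l , u , v , eq , j = x ∷ l , u , v , cong (x ∷_) eq , j

-- Again `τ` is the side where the next zigzag starts; `z` is the `k`-th label counted from the
-- opposite end of the interval.
End : Side → ℕ → ℕ → ℕ → ℕ → Set
End high k z a n = suc z ≡ a + k
End low  k z a n = z + k ≡ a + n

-- Of the p elements of a zigzag starting at side τ, k lie at side σ.
Depth : Side → ℕ → ℕ → Side → Set
Depth τ p k low  = lows τ p ≡ k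
Depth τ p k high = lows τ p + k ≡ p

depth-step : ∀ τ {p k} σ → Depth τ p k σ → Depth τ (2 + p) (suc k) σ
depth-step low  low  h = cong suc h
depth-step high low  h = cong suc h
depth-step low  high h = cong suc (trans (+-suc _ _) (cong suc h))
depth-step high high h = cong suc (trans (+-suc _ _) (cong suc h))

depth-start : ∀ τ p → Depth τ p ⌈ p /2⌉ τ
depth-start low  0 = refl
depth-start high 0 = refl
depth-start low  1 = refl
depth-start high 1 = refl
depth-start τ (suc (suc p)) = depth-step τ τ (depth-start τ p)

opp-opp : ∀ τ → opp (opp τ) ≡ τ
opp-opp low  = refl
opp-opp high = refl

-- An even zigzag puts half of its labels on each side, an odd one finishes on the side where it
-- started. So the first and the last side both receive `⌈ p /2⌉` labels, and one `k` serves for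
-- entering and for leaving a zigzag.
depth-end : ∀ τ p → Depth τ p ⌈ p /2⌉ (opp (next τ p))
depth-end low  0 = refl
depth-end high 0 = refl
depth-end low  1 = refl
depth-end high 1 = refl
depth-end τ (suc (suc p)) rewrite opp-opp τ = depth-step τ _ (depth-end τ p)

-- The jump into the zigzag supplies `n`, the one difference missing between those of the old
-- labelling and those of the zigzag. In the high case `z` lies n - k below the top of the old
-- interval and `k` labels are added above it; the low case is the mirror image.
enter : ∀ τ p {k z a n} → Depth τ (suc p) k τ → End τ k z (off τ (suc p) a) n →
        ∣ z - first τ a (p + n) ∣ ≡ n
enter low p {k} {z} {a} {n} h e = trans (cong (λ y → ∣ y - a ∣) z≡) (trans (∣-∣-comm (a + n) a) (∣m-m+n∣≡n a n))
  where
  z≡ : z ≡ a + n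
  z≡ = +-cancelʳ-≡ k z (a + n) (trans e (trans (cong (_+ n) (trans (off-lows low (suc p) a)
    (trans (cong (_+ a) h) (+-comm k a)))) (trans (+-assoc a k n) (trans (cong (a +_) (+-comm k n)) (sym (+-assoc a n k))))))
enter high p {k} {z} {a} {n} h e = trans (cong₂ ∣_-_∣ z≡ (sym (+-assoc a p n))) (∣m-m+n∣≡n (a + p) n)
  where
  z≡ : z ≡ a + p
  z≡ = suc-injective (trans e (trans (cong (_+ k) (trans (off-lows high (suc p) a) (+-comm _ a)))
    (trans (+-assoc a _ k) (trans (cong (a +_) h) (+-suc a p)))))

-- The last label of the zigzag borders the inner interval, so the labels from it to the outer end
-- are exactly the `k` taken at that side.
leave : ∀ τ p σ {k z a n} → Depth τ p k (opp σ) → Outside σ z (off τ p a) n → End σ k z a (p + n)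
leave τ p high {k} {z} {a} h o = trans o (trans (off-lows τ p a) (trans (cong (_+ a) h) (+-comm k a)))
leave τ p low {k} {z} {a} {n} h o = trans (cong (_+ k) (trans o (cong (_+ n) (off-lows τ p a)))) (begin
  lows τ p + a + n + k     ≡⟨ cong (_+ k) (trans (cong (_+ n) (+-comm _ a)) (+-assoc a _ n)) ⟩
  a + (lows τ p + n) + k   ≡⟨ +-assoc a _ k ⟩
  a + (lows τ p + n + k)   ≡⟨ cong (a +_) (trans (+-assoc _ n k) (trans (cong (lows τ p +_) (+-comm n k)) (sym (+-assoc _ k n)))) ⟩
  a + (lows τ p + k + n)   ≡⟨ cong (λ y → a + (y + n)) h ⟩
  a + (p + n)              ∎)
  where open ≡-Reasoning

-- Differences below `n` come from `w`, the difference `n` from the junction, and the larger ones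
-- from the zigzag.
extend : ∀ τ p {k a n w l z} → Depth τ (suc p) k τ → w ≡ l ∷ʳ z → End τ k z (off τ (suc p) a) n →
         Graceful (off τ (suc p) a) n w → Graceful a (suc p + n) (w ++ zig τ (suc p) a n)
extend τ p {k} {a} {n} {w} {l} {z} h refl e G = record
  { size   = trans (length-++ w) (trans (cong₂ _+_ size (length-zig τ (suc p) a n)) (+-comm n (suc p)))
  ; covers = cov
  ; jumps  = jmp
  }
  where
  open Graceful G
  cov : ∀ {x} → a ≤ x → x < a + (suc p + n) → x ∈ w ++ zig τ (suc p) a n
  cov a≤x x< with zig-covers τ (suc p) a n a≤x x<
  ... | inj₁ x∈       = ∈-++⁺ʳ w x∈
  ... | inj₂ (o≤ , <o) = ∈-++⁺ˡ (covers o≤ <o)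
  jmp : ∀ {d} → 0 < d → d < suc p + n → ∃₂ λ x y → Adjacent x y (w ++ zig τ (suc p) a n) × ∣ x - y ∣ ≡ d
  jmp {d} 0<d d< with <-cmp d n
  ... | tri< d<n _ _ = let u , v , q , eq = jumps 0<d d<n in u , v , adj-++ˡ q , eq
  ... | tri≈ _ refl _ = z , _ , adj-link l z _ , enter τ p h e
  ... | tri> _ _ n<d = let u , v , q , eq = zig-jumps (opp τ) p (outside-first τ a (p + n)) n<d (s≤s⁻¹ d<)
                       in u , v , adj-++ʳ w q , eq

-- Tabulated labellings

-- For 1 ≤ k ≤ 20, graceful labellings by 0, …, r - 1 of paths that start in the middle of the interval and end at
-- k - 1. They come from a computer search, for k ≤ r ≤ 20; if both ends would be forced to coincide, r is replaced by
-- r + p for the p with k = ⌈p/2⌉.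
bases : ℕ → List (List ℕ)
bases 1 =
  (0 ∷ []) ∷
  (1 ∷ 0 ∷ []) ∷
  (1 ∷ 2 ∷ 0 ∷ []) ∷
  (2 ∷ 1 ∷ 3 ∷ 0 ∷ []) ∷
  (2 ∷ 3 ∷ 1 ∷ 4 ∷ 0 ∷ []) ∷
  (3 ∷ 2 ∷ 4 ∷ 1 ∷ 5 ∷ 0 ∷ []) ∷
  (3 ∷ 4 ∷ 2 ∷ 5 ∷ 1 ∷ 6 ∷ 0 ∷ []) ∷
  (4 ∷ 3 ∷ 5 ∷ 2 ∷ 6 ∷ 1 ∷ 7 ∷ 0 ∷ []) ∷
  (4 ∷ 5 ∷ 3 ∷ 6 ∷ 2 ∷ 7 ∷ 1 ∷ 8 ∷ 0 ∷ []) ∷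
  (5 ∷ 4 ∷ 6 ∷ 3 ∷ 7 ∷ 2 ∷ 8 ∷ 1 ∷ 9 ∷ 0 ∷ []) ∷
  (5 ∷ 6 ∷ 4 ∷ 7 ∷ 3 ∷ 8 ∷ 2 ∷ 9 ∷ 1 ∷ 10 ∷ 0 ∷ []) ∷
  (6 ∷ 5 ∷ 7 ∷ 4 ∷ 8 ∷ 3 ∷ 9 ∷ 2 ∷ 10 ∷ 1 ∷ 11 ∷ 0 ∷ []) ∷
  (6 ∷ 7 ∷ 5 ∷ 8 ∷ 4 ∷ 9 ∷ 3 ∷ 10 ∷ 2 ∷ 11 ∷ 1 ∷ 12 ∷ 0 ∷ []) ∷
  (7 ∷ 6 ∷ 8 ∷ 5 ∷ 9 ∷ 4 ∷ 10 ∷ 3 ∷ 11 ∷ 2 ∷ 12 ∷ 1 ∷ 13 ∷ 0 ∷ []) ∷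
  (7 ∷ 8 ∷ 6 ∷ 9 ∷ 5 ∷ 10 ∷ 4 ∷ 11 ∷ 3 ∷ 12 ∷ 2 ∷ 13 ∷ 1 ∷ 14 ∷ 0 ∷ []) ∷
  (8 ∷ 7 ∷ 9 ∷ 6 ∷ 10 ∷ 5 ∷ 11 ∷ 4 ∷ 12 ∷ 3 ∷ 13 ∷ 2 ∷ 14 ∷ 1 ∷ 15 ∷ 0 ∷ []) ∷
  (8 ∷ 9 ∷ 7 ∷ 10 ∷ 6 ∷ 11 ∷ 5 ∷ 12 ∷ 4 ∷ 13 ∷ 3 ∷ 14 ∷ 2 ∷ 15 ∷ 1 ∷ 16 ∷ 0 ∷ []) ∷
  (9 ∷ 8 ∷ 10 ∷ 7 ∷ 11 ∷ 6 ∷ 12 ∷ 5 ∷ 13 ∷ 4 ∷ 14 ∷ 3 ∷ 15 ∷ 2 ∷ 16 ∷ 1 ∷ 17 ∷ 0 ∷ []) ∷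
  (9 ∷ 10 ∷ 8 ∷ 11 ∷ 7 ∷ 12 ∷ 6 ∷ 13 ∷ 5 ∷ 14 ∷ 4 ∷ 15 ∷ 3 ∷ 16 ∷ 2 ∷ 17 ∷ 1 ∷ 18 ∷ 0 ∷ []) ∷
  (10 ∷ 9 ∷ 11 ∷ 8 ∷ 12 ∷ 7 ∷ 13 ∷ 6 ∷ 14 ∷ 5 ∷ 15 ∷ 4 ∷ 16 ∷ 3 ∷ 17 ∷ 2 ∷ 18 ∷ 1 ∷ 19 ∷ 0 ∷ []) ∷
  []
bases 2 =
  (0 ∷ 1 ∷ []) ∷
  (2 ∷ 0 ∷ 1 ∷ []) ∷
  (3 ∷ 0 ∷ 4 ∷ 2 ∷ 1 ∷ []) ∷
  (2 ∷ 3 ∷ 5 ∷ 0 ∷ 4 ∷ 1 ∷ []) ∷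
  (4 ∷ 2 ∷ 3 ∷ 6 ∷ 0 ∷ 5 ∷ 1 ∷ []) ∷
  (3 ∷ 4 ∷ 6 ∷ 0 ∷ 7 ∷ 2 ∷ 5 ∷ 1 ∷ []) ∷
  (5 ∷ 2 ∷ 6 ∷ 4 ∷ 3 ∷ 8 ∷ 0 ∷ 7 ∷ 1 ∷ []) ∷
  (4 ∷ 5 ∷ 7 ∷ 2 ∷ 6 ∷ 3 ∷ 9 ∷ 0 ∷ 8 ∷ 1 ∷ []) ∷
  (6 ∷ 4 ∷ 5 ∷ 8 ∷ 2 ∷ 7 ∷ 3 ∷ 10 ∷ 0 ∷ 9 ∷ 1 ∷ []) ∷
  (5 ∷ 6 ∷ 8 ∷ 2 ∷ 9 ∷ 4 ∷ 7 ∷ 3 ∷ 11 ∷ 0 ∷ 10 ∷ 1 ∷ []) ∷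
  (7 ∷ 4 ∷ 8 ∷ 6 ∷ 5 ∷ 10 ∷ 2 ∷ 9 ∷ 3 ∷ 12 ∷ 0 ∷ 11 ∷ 1 ∷ []) ∷
  (6 ∷ 7 ∷ 9 ∷ 4 ∷ 8 ∷ 5 ∷ 11 ∷ 2 ∷ 10 ∷ 3 ∷ 13 ∷ 0 ∷ 12 ∷ 1 ∷ []) ∷
  (8 ∷ 6 ∷ 7 ∷ 10 ∷ 4 ∷ 9 ∷ 5 ∷ 12 ∷ 2 ∷ 11 ∷ 3 ∷ 14 ∷ 0 ∷ 13 ∷ 1 ∷ []) ∷
  (7 ∷ 8 ∷ 10 ∷ 4 ∷ 11 ∷ 6 ∷ 9 ∷ 5 ∷ 13 ∷ 2 ∷ 12 ∷ 3 ∷ 15 ∷ 0 ∷ 14 ∷ 1 ∷ []) ∷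
  (9 ∷ 6 ∷ 10 ∷ 8 ∷ 7 ∷ 12 ∷ 4 ∷ 11 ∷ 5 ∷ 14 ∷ 2 ∷ 13 ∷ 3 ∷ 16 ∷ 0 ∷ 15 ∷ 1 ∷ []) ∷
  (8 ∷ 9 ∷ 11 ∷ 6 ∷ 10 ∷ 7 ∷ 13 ∷ 4 ∷ 12 ∷ 5 ∷ 15 ∷ 2 ∷ 14 ∷ 3 ∷ 17 ∷ 0 ∷ 16 ∷ 1 ∷ []) ∷
  (10 ∷ 8 ∷ 9 ∷ 12 ∷ 6 ∷ 11 ∷ 7 ∷ 14 ∷ 4 ∷ 13 ∷ 5 ∷ 16 ∷ 2 ∷ 15 ∷ 3 ∷ 18 ∷ 0 ∷ 17 ∷ 1 ∷ []) ∷
  (9 ∷ 10 ∷ 12 ∷ 6 ∷ 13 ∷ 8 ∷ 11 ∷ 7 ∷ 15 ∷ 4 ∷ 14 ∷ 5 ∷ 17 ∷ 2 ∷ 16 ∷ 3 ∷ 19 ∷ 0 ∷ 18 ∷ 1 ∷ []) ∷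
  []
bases 3 =
  (1 ∷ 0 ∷ 2 ∷ []) ∷
  (3 ∷ 5 ∷ 0 ∷ 4 ∷ 1 ∷ 2 ∷ []) ∷
  (3 ∷ 1 ∷ 4 ∷ 5 ∷ 0 ∷ 6 ∷ 2 ∷ []) ∷
  (4 ∷ 7 ∷ 0 ∷ 6 ∷ 1 ∷ 5 ∷ 3 ∷ 2 ∷ []) ∷
  (4 ∷ 3 ∷ 5 ∷ 8 ∷ 0 ∷ 7 ∷ 1 ∷ 6 ∷ 2 ∷ []) ∷
  (5 ∷ 7 ∷ 1 ∷ 8 ∷ 0 ∷ 9 ∷ 4 ∷ 3 ∷ 6 ∷ 2 ∷ []) ∷
  (5 ∷ 4 ∷ 10 ∷ 0 ∷ 9 ∷ 1 ∷ 8 ∷ 6 ∷ 3 ∷ 7 ∷ 2 ∷ []) ∷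
  (6 ∷ 8 ∷ 3 ∷ 7 ∷ 4 ∷ 5 ∷ 11 ∷ 0 ∷ 10 ∷ 1 ∷ 9 ∷ 2 ∷ []) ∷
  (6 ∷ 4 ∷ 7 ∷ 8 ∷ 3 ∷ 9 ∷ 5 ∷ 12 ∷ 0 ∷ 11 ∷ 1 ∷ 10 ∷ 2 ∷ []) ∷
  (7 ∷ 10 ∷ 3 ∷ 9 ∷ 4 ∷ 8 ∷ 6 ∷ 5 ∷ 13 ∷ 0 ∷ 12 ∷ 1 ∷ 11 ∷ 2 ∷ []) ∷
  (7 ∷ 6 ∷ 8 ∷ 11 ∷ 3 ∷ 10 ∷ 4 ∷ 9 ∷ 5 ∷ 14 ∷ 0 ∷ 13 ∷ 1 ∷ 12 ∷ 2 ∷ []) ∷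
  (8 ∷ 10 ∷ 4 ∷ 11 ∷ 3 ∷ 12 ∷ 7 ∷ 6 ∷ 9 ∷ 5 ∷ 15 ∷ 0 ∷ 14 ∷ 1 ∷ 13 ∷ 2 ∷ []) ∷
  (8 ∷ 7 ∷ 13 ∷ 3 ∷ 12 ∷ 4 ∷ 11 ∷ 9 ∷ 6 ∷ 10 ∷ 5 ∷ 16 ∷ 0 ∷ 15 ∷ 1 ∷ 14 ∷ 2 ∷ []) ∷
  (9 ∷ 11 ∷ 6 ∷ 10 ∷ 7 ∷ 8 ∷ 14 ∷ 3 ∷ 13 ∷ 4 ∷ 12 ∷ 5 ∷ 17 ∷ 0 ∷ 16 ∷ 1 ∷ 15 ∷ 2 ∷ []) ∷
  (9 ∷ 7 ∷ 10 ∷ 11 ∷ 6 ∷ 12 ∷ 8 ∷ 15 ∷ 3 ∷ 14 ∷ 4 ∷ 13 ∷ 5 ∷ 18 ∷ 0 ∷ 17 ∷ 1 ∷ 16 ∷ 2 ∷ []) ∷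
  (10 ∷ 13 ∷ 6 ∷ 12 ∷ 7 ∷ 11 ∷ 9 ∷ 8 ∷ 16 ∷ 3 ∷ 15 ∷ 4 ∷ 14 ∷ 5 ∷ 19 ∷ 0 ∷ 18 ∷ 1 ∷ 17 ∷ 2 ∷ []) ∷
  []
bases 4 =
  (1 ∷ 2 ∷ 0 ∷ 3 ∷ []) ∷
  (2 ∷ 1 ∷ 4 ∷ 0 ∷ 5 ∷ 3 ∷ []) ∷
  (4 ∷ 2 ∷ 1 ∷ 5 ∷ 0 ∷ 6 ∷ 3 ∷ []) ∷
  (5 ∷ 8 ∷ 0 ∷ 7 ∷ 1 ∷ 6 ∷ 2 ∷ 4 ∷ 3 ∷ []) ∷
  (4 ∷ 2 ∷ 7 ∷ 1 ∷ 8 ∷ 0 ∷ 9 ∷ 5 ∷ 6 ∷ 3 ∷ []) ∷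
  (6 ∷ 10 ∷ 0 ∷ 9 ∷ 1 ∷ 8 ∷ 2 ∷ 7 ∷ 4 ∷ 5 ∷ 3 ∷ []) ∷
  (5 ∷ 6 ∷ 4 ∷ 7 ∷ 11 ∷ 0 ∷ 10 ∷ 1 ∷ 9 ∷ 2 ∷ 8 ∷ 3 ∷ []) ∷
  (7 ∷ 4 ∷ 5 ∷ 9 ∷ 2 ∷ 10 ∷ 1 ∷ 11 ∷ 0 ∷ 12 ∷ 6 ∷ 8 ∷ 3 ∷ []) ∷
  (6 ∷ 5 ∷ 8 ∷ 4 ∷ 9 ∷ 7 ∷ 13 ∷ 0 ∷ 12 ∷ 1 ∷ 11 ∷ 2 ∷ 10 ∷ 3 ∷ []) ∷
  (8 ∷ 6 ∷ 5 ∷ 9 ∷ 4 ∷ 10 ∷ 7 ∷ 14 ∷ 0 ∷ 13 ∷ 1 ∷ 12 ∷ 2 ∷ 11 ∷ 3 ∷ []) ∷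
  (7 ∷ 8 ∷ 6 ∷ 15 ∷ 0 ∷ 14 ∷ 1 ∷ 13 ∷ 2 ∷ 12 ∷ 9 ∷ 5 ∷ 10 ∷ 4 ∷ 11 ∷ 3 ∷ []) ∷
  (9 ∷ 12 ∷ 4 ∷ 11 ∷ 5 ∷ 10 ∷ 6 ∷ 8 ∷ 7 ∷ 16 ∷ 0 ∷ 15 ∷ 1 ∷ 14 ∷ 2 ∷ 13 ∷ 3 ∷ []) ∷
  (8 ∷ 6 ∷ 11 ∷ 5 ∷ 12 ∷ 4 ∷ 13 ∷ 9 ∷ 10 ∷ 7 ∷ 17 ∷ 0 ∷ 16 ∷ 1 ∷ 15 ∷ 2 ∷ 14 ∷ 3 ∷ []) ∷
  (10 ∷ 14 ∷ 4 ∷ 13 ∷ 5 ∷ 12 ∷ 6 ∷ 11 ∷ 8 ∷ 9 ∷ 7 ∷ 18 ∷ 0 ∷ 17 ∷ 1 ∷ 16 ∷ 2 ∷ 15 ∷ 3 ∷ []) ∷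
  (9 ∷ 10 ∷ 8 ∷ 11 ∷ 15 ∷ 4 ∷ 14 ∷ 5 ∷ 13 ∷ 6 ∷ 12 ∷ 7 ∷ 19 ∷ 0 ∷ 18 ∷ 1 ∷ 17 ∷ 2 ∷ 16 ∷ 3 ∷ []) ∷
  []
bases 5 =
  (2 ∷ 1 ∷ 3 ∷ 0 ∷ 4 ∷ []) ∷
  (3 ∷ 1 ∷ 2 ∷ 5 ∷ 0 ∷ 4 ∷ []) ∷
  (3 ∷ 6 ∷ 0 ∷ 5 ∷ 1 ∷ 2 ∷ 4 ∷ []) ∷
  (5 ∷ 9 ∷ 0 ∷ 8 ∷ 1 ∷ 7 ∷ 2 ∷ 3 ∷ 6 ∷ 4 ∷ []) ∷
  (5 ∷ 7 ∷ 2 ∷ 8 ∷ 1 ∷ 9 ∷ 0 ∷ 10 ∷ 6 ∷ 3 ∷ 4 ∷ []) ∷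
  (6 ∷ 3 ∷ 8 ∷ 2 ∷ 9 ∷ 1 ∷ 10 ∷ 0 ∷ 11 ∷ 7 ∷ 5 ∷ 4 ∷ []) ∷
  (6 ∷ 7 ∷ 12 ∷ 0 ∷ 11 ∷ 1 ∷ 10 ∷ 2 ∷ 9 ∷ 3 ∷ 5 ∷ 8 ∷ 4 ∷ []) ∷
  (7 ∷ 5 ∷ 6 ∷ 9 ∷ 3 ∷ 10 ∷ 2 ∷ 11 ∷ 1 ∷ 12 ∷ 0 ∷ 13 ∷ 8 ∷ 4 ∷ []) ∷
  (7 ∷ 6 ∷ 8 ∷ 5 ∷ 9 ∷ 14 ∷ 0 ∷ 13 ∷ 1 ∷ 12 ∷ 2 ∷ 11 ∷ 3 ∷ 10 ∷ 4 ∷ []) ∷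
  (8 ∷ 6 ∷ 7 ∷ 10 ∷ 5 ∷ 9 ∷ 15 ∷ 0 ∷ 14 ∷ 1 ∷ 13 ∷ 2 ∷ 12 ∷ 3 ∷ 11 ∷ 4 ∷ []) ∷
  (8 ∷ 11 ∷ 5 ∷ 10 ∷ 6 ∷ 7 ∷ 9 ∷ 16 ∷ 0 ∷ 15 ∷ 1 ∷ 14 ∷ 2 ∷ 13 ∷ 3 ∷ 12 ∷ 4 ∷ []) ∷
  (9 ∷ 7 ∷ 8 ∷ 17 ∷ 0 ∷ 16 ∷ 1 ∷ 15 ∷ 2 ∷ 14 ∷ 3 ∷ 13 ∷ 10 ∷ 6 ∷ 11 ∷ 5 ∷ 12 ∷ 4 ∷ []) ∷
  (9 ∷ 6 ∷ 10 ∷ 8 ∷ 18 ∷ 0 ∷ 17 ∷ 1 ∷ 16 ∷ 2 ∷ 15 ∷ 3 ∷ 14 ∷ 7 ∷ 12 ∷ 11 ∷ 5 ∷ 13 ∷ 4 ∷ []) ∷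
  (10 ∷ 14 ∷ 5 ∷ 13 ∷ 6 ∷ 12 ∷ 7 ∷ 8 ∷ 11 ∷ 9 ∷ 19 ∷ 0 ∷ 18 ∷ 1 ∷ 17 ∷ 2 ∷ 16 ∷ 3 ∷ 15 ∷ 4 ∷ []) ∷
  []
bases 6 =
  (2 ∷ 3 ∷ 1 ∷ 4 ∷ 0 ∷ 5 ∷ []) ∷
  (4 ∷ 1 ∷ 3 ∷ 2 ∷ 6 ∷ 0 ∷ 5 ∷ []) ∷
  (3 ∷ 2 ∷ 4 ∷ 7 ∷ 0 ∷ 6 ∷ 1 ∷ 5 ∷ []) ∷
  (4 ∷ 6 ∷ 3 ∷ 2 ∷ 7 ∷ 1 ∷ 8 ∷ 0 ∷ 9 ∷ 5 ∷ []) ∷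
  (6 ∷ 10 ∷ 0 ∷ 9 ∷ 1 ∷ 8 ∷ 2 ∷ 7 ∷ 4 ∷ 3 ∷ 5 ∷ []) ∷
  (7 ∷ 12 ∷ 0 ∷ 11 ∷ 1 ∷ 10 ∷ 2 ∷ 9 ∷ 3 ∷ 6 ∷ 8 ∷ 4 ∷ 5 ∷ []) ∷
  (6 ∷ 4 ∷ 7 ∷ 8 ∷ 13 ∷ 0 ∷ 12 ∷ 1 ∷ 11 ∷ 2 ∷ 10 ∷ 3 ∷ 9 ∷ 5 ∷ []) ∷
  (8 ∷ 4 ∷ 10 ∷ 3 ∷ 11 ∷ 2 ∷ 12 ∷ 1 ∷ 13 ∷ 0 ∷ 14 ∷ 9 ∷ 6 ∷ 7 ∷ 5 ∷ []) ∷
  (7 ∷ 6 ∷ 9 ∷ 15 ∷ 0 ∷ 14 ∷ 1 ∷ 13 ∷ 2 ∷ 12 ∷ 3 ∷ 11 ∷ 4 ∷ 8 ∷ 10 ∷ 5 ∷ []) ∷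
  (9 ∷ 6 ∷ 8 ∷ 7 ∷ 11 ∷ 4 ∷ 12 ∷ 3 ∷ 13 ∷ 2 ∷ 14 ∷ 1 ∷ 15 ∷ 0 ∷ 16 ∷ 10 ∷ 5 ∷ []) ∷
  (8 ∷ 9 ∷ 7 ∷ 10 ∷ 6 ∷ 11 ∷ 17 ∷ 0 ∷ 16 ∷ 1 ∷ 15 ∷ 2 ∷ 14 ∷ 3 ∷ 13 ∷ 4 ∷ 12 ∷ 5 ∷ []) ∷
  (10 ∷ 7 ∷ 9 ∷ 8 ∷ 12 ∷ 6 ∷ 11 ∷ 18 ∷ 0 ∷ 17 ∷ 1 ∷ 16 ∷ 2 ∷ 15 ∷ 3 ∷ 14 ∷ 4 ∷ 13 ∷ 5 ∷ []) ∷
  (9 ∷ 8 ∷ 10 ∷ 13 ∷ 6 ∷ 12 ∷ 7 ∷ 11 ∷ 19 ∷ 0 ∷ 18 ∷ 1 ∷ 17 ∷ 2 ∷ 16 ∷ 3 ∷ 15 ∷ 4 ∷ 14 ∷ 5 ∷ []) ∷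
  (11 ∷ 15 ∷ 4 ∷ 16 ∷ 3 ∷ 17 ∷ 2 ∷ 18 ∷ 1 ∷ 19 ∷ 0 ∷ 20 ∷ 10 ∷ 8 ∷ 9 ∷ 12 ∷ 7 ∷ 13 ∷ 6 ∷ 14 ∷ 5 ∷ []) ∷
  (12 ∷ 16 ∷ 6 ∷ 15 ∷ 7 ∷ 14 ∷ 8 ∷ 13 ∷ 10 ∷ 9 ∷ 11 ∷ 22 ∷ 0 ∷ 21 ∷ 1 ∷ 20 ∷ 2 ∷ 19 ∷ 3 ∷ 18 ∷ 4 ∷ 17 ∷ 5 ∷ []) ∷
  (11 ∷ 10 ∷ 23 ∷ 0 ∷ 22 ∷ 1 ∷ 21 ∷ 2 ∷ 20 ∷ 3 ∷ 19 ∷ 4 ∷ 18 ∷ 13 ∷ 9 ∷ 12 ∷ 14 ∷ 8 ∷ 15 ∷ 7 ∷ 16 ∷ 6 ∷ 17 ∷ 5 ∷ []) ∷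
  []
bases 7 =
  (3 ∷ 2 ∷ 4 ∷ 1 ∷ 5 ∷ 0 ∷ 6 ∷ []) ∷
  (4 ∷ 1 ∷ 5 ∷ 3 ∷ 2 ∷ 7 ∷ 0 ∷ 6 ∷ []) ∷
  (4 ∷ 7 ∷ 0 ∷ 8 ∷ 2 ∷ 3 ∷ 5 ∷ 1 ∷ 6 ∷ []) ∷
  (5 ∷ 9 ∷ 0 ∷ 8 ∷ 1 ∷ 7 ∷ 2 ∷ 4 ∷ 3 ∷ 6 ∷ []) ∷
  (5 ∷ 3 ∷ 4 ∷ 7 ∷ 2 ∷ 8 ∷ 1 ∷ 9 ∷ 0 ∷ 10 ∷ 6 ∷ []) ∷
  (7 ∷ 5 ∷ 4 ∷ 8 ∷ 13 ∷ 0 ∷ 12 ∷ 1 ∷ 11 ∷ 2 ∷ 10 ∷ 3 ∷ 9 ∷ 6 ∷ []) ∷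
  (7 ∷ 9 ∷ 14 ∷ 0 ∷ 13 ∷ 1 ∷ 12 ∷ 2 ∷ 11 ∷ 3 ∷ 10 ∷ 4 ∷ 8 ∷ 5 ∷ 6 ∷ []) ∷
  (8 ∷ 4 ∷ 11 ∷ 3 ∷ 12 ∷ 2 ∷ 13 ∷ 1 ∷ 14 ∷ 0 ∷ 15 ∷ 9 ∷ 7 ∷ 10 ∷ 5 ∷ 6 ∷ []) ∷
  (8 ∷ 11 ∷ 4 ∷ 12 ∷ 3 ∷ 13 ∷ 2 ∷ 14 ∷ 1 ∷ 15 ∷ 0 ∷ 16 ∷ 10 ∷ 5 ∷ 9 ∷ 7 ∷ 6 ∷ []) ∷
  (9 ∷ 7 ∷ 8 ∷ 11 ∷ 17 ∷ 0 ∷ 16 ∷ 1 ∷ 15 ∷ 2 ∷ 14 ∷ 3 ∷ 13 ∷ 4 ∷ 12 ∷ 5 ∷ 10 ∷ 6 ∷ []) ∷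
  (9 ∷ 11 ∷ 18 ∷ 0 ∷ 17 ∷ 1 ∷ 16 ∷ 2 ∷ 15 ∷ 3 ∷ 14 ∷ 4 ∷ 13 ∷ 5 ∷ 10 ∷ 7 ∷ 8 ∷ 12 ∷ 6 ∷ []) ∷
  (10 ∷ 7 ∷ 11 ∷ 9 ∷ 8 ∷ 13 ∷ 5 ∷ 14 ∷ 4 ∷ 15 ∷ 3 ∷ 16 ∷ 2 ∷ 17 ∷ 1 ∷ 18 ∷ 0 ∷ 19 ∷ 12 ∷ 6 ∷ []) ∷
  (12 ∷ 10 ∷ 11 ∷ 14 ∷ 9 ∷ 15 ∷ 8 ∷ 16 ∷ 7 ∷ 17 ∷ 13 ∷ 24 ∷ 0 ∷ 23 ∷ 1 ∷ 22 ∷ 2 ∷ 21 ∷ 3 ∷ 20 ∷ 4 ∷ 19 ∷ 5 ∷ 18 ∷ 6 ∷ []) ∷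
  (13 ∷ 11 ∷ 10 ∷ 14 ∷ 19 ∷ 5 ∷ 20 ∷ 4 ∷ 21 ∷ 3 ∷ 22 ∷ 2 ∷ 23 ∷ 1 ∷ 24 ∷ 0 ∷ 25 ∷ 12 ∷ 15 ∷ 9 ∷ 16 ∷ 8 ∷ 17 ∷ 7 ∷ 18 ∷ 6 ∷ []) ∷
  (13 ∷ 15 ∷ 20 ∷ 5 ∷ 21 ∷ 4 ∷ 22 ∷ 3 ∷ 23 ∷ 2 ∷ 24 ∷ 1 ∷ 25 ∷ 0 ∷ 26 ∷ 12 ∷ 11 ∷ 14 ∷ 10 ∷ 16 ∷ 9 ∷ 17 ∷ 8 ∷ 18 ∷ 7 ∷ 19 ∷ 6 ∷ []) ∷
  []
bases 8 =
  (3 ∷ 4 ∷ 2 ∷ 5 ∷ 1 ∷ 6 ∷ 0 ∷ 7 ∷ []) ∷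
  (5 ∷ 1 ∷ 6 ∷ 3 ∷ 4 ∷ 2 ∷ 8 ∷ 0 ∷ 7 ∷ []) ∷
  (4 ∷ 3 ∷ 9 ∷ 0 ∷ 8 ∷ 1 ∷ 6 ∷ 2 ∷ 5 ∷ 7 ∷ []) ∷
  (6 ∷ 2 ∷ 8 ∷ 1 ∷ 9 ∷ 0 ∷ 10 ∷ 5 ∷ 3 ∷ 4 ∷ 7 ∷ []) ∷
  (5 ∷ 4 ∷ 6 ∷ 3 ∷ 8 ∷ 2 ∷ 9 ∷ 1 ∷ 10 ∷ 0 ∷ 11 ∷ 7 ∷ []) ∷
  (6 ∷ 9 ∷ 3 ∷ 10 ∷ 2 ∷ 11 ∷ 1 ∷ 12 ∷ 0 ∷ 13 ∷ 8 ∷ 4 ∷ 5 ∷ 7 ∷ []) ∷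
  (8 ∷ 4 ∷ 10 ∷ 3 ∷ 11 ∷ 2 ∷ 12 ∷ 1 ∷ 13 ∷ 0 ∷ 14 ∷ 9 ∷ 6 ∷ 5 ∷ 7 ∷ []) ∷
  (9 ∷ 5 ∷ 10 ∷ 16 ∷ 0 ∷ 15 ∷ 1 ∷ 14 ∷ 2 ∷ 13 ∷ 3 ∷ 12 ∷ 4 ∷ 11 ∷ 8 ∷ 6 ∷ 7 ∷ []) ∷
  (8 ∷ 6 ∷ 9 ∷ 10 ∷ 5 ∷ 12 ∷ 4 ∷ 13 ∷ 3 ∷ 14 ∷ 2 ∷ 15 ∷ 1 ∷ 16 ∷ 0 ∷ 17 ∷ 11 ∷ 7 ∷ []) ∷
  (10 ∷ 5 ∷ 13 ∷ 4 ∷ 14 ∷ 3 ∷ 15 ∷ 2 ∷ 16 ∷ 1 ∷ 17 ∷ 0 ∷ 18 ∷ 11 ∷ 9 ∷ 6 ∷ 12 ∷ 8 ∷ 7 ∷ []) ∷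
  (9 ∷ 8 ∷ 10 ∷ 13 ∷ 5 ∷ 14 ∷ 4 ∷ 15 ∷ 3 ∷ 16 ∷ 2 ∷ 17 ∷ 1 ∷ 18 ∷ 0 ∷ 19 ∷ 12 ∷ 6 ∷ 11 ∷ 7 ∷ []) ∷
  (13 ∷ 12 ∷ 14 ∷ 11 ∷ 16 ∷ 10 ∷ 17 ∷ 9 ∷ 18 ∷ 8 ∷ 19 ∷ 15 ∷ 27 ∷ 0 ∷ 26 ∷ 1 ∷ 25 ∷ 2 ∷ 24 ∷ 3 ∷ 23 ∷ 4 ∷ 22 ∷ 5 ∷ 21 ∷ 6 ∷ 20 ∷ 7 ∷ []) ∷
  (15 ∷ 13 ∷ 12 ∷ 16 ∷ 21 ∷ 6 ∷ 22 ∷ 5 ∷ 23 ∷ 4 ∷ 24 ∷ 3 ∷ 25 ∷ 2 ∷ 26 ∷ 1 ∷ 27 ∷ 0 ∷ 28 ∷ 14 ∷ 11 ∷ 17 ∷ 10 ∷ 18 ∷ 9 ∷ 19 ∷ 8 ∷ 20 ∷ 7 ∷ []) ∷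
  (16 ∷ 12 ∷ 18 ∷ 11 ∷ 19 ∷ 10 ∷ 20 ∷ 9 ∷ 21 ∷ 8 ∷ 22 ∷ 17 ∷ 14 ∷ 13 ∷ 15 ∷ 30 ∷ 0 ∷ 29 ∷ 1 ∷ 28 ∷ 2 ∷ 27 ∷ 3 ∷ 26 ∷ 4 ∷ 25 ∷ 5 ∷ 24 ∷ 6 ∷ 23 ∷ 7 ∷ []) ∷
  (15 ∷ 14 ∷ 31 ∷ 0 ∷ 30 ∷ 1 ∷ 29 ∷ 2 ∷ 28 ∷ 3 ∷ 27 ∷ 4 ∷ 26 ∷ 5 ∷ 25 ∷ 6 ∷ 24 ∷ 18 ∷ 16 ∷ 13 ∷ 17 ∷ 12 ∷ 19 ∷ 11 ∷ 20 ∷ 10 ∷ 21 ∷ 9 ∷ 22 ∷ 8 ∷ 23 ∷ 7 ∷ []) ∷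
  []
bases 9 =
  (4 ∷ 3 ∷ 5 ∷ 2 ∷ 6 ∷ 1 ∷ 7 ∷ 0 ∷ 8 ∷ []) ∷
  (5 ∷ 3 ∷ 4 ∷ 7 ∷ 1 ∷ 6 ∷ 2 ∷ 9 ∷ 0 ∷ 8 ∷ []) ∷
  (5 ∷ 7 ∷ 2 ∷ 6 ∷ 3 ∷ 4 ∷ 10 ∷ 0 ∷ 9 ∷ 1 ∷ 8 ∷ []) ∷
  (6 ∷ 4 ∷ 3 ∷ 7 ∷ 2 ∷ 9 ∷ 1 ∷ 10 ∷ 0 ∷ 11 ∷ 5 ∷ 8 ∷ []) ∷
  (6 ∷ 3 ∷ 9 ∷ 2 ∷ 10 ∷ 1 ∷ 11 ∷ 0 ∷ 12 ∷ 7 ∷ 5 ∷ 4 ∷ 8 ∷ []) ∷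
  (7 ∷ 4 ∷ 6 ∷ 5 ∷ 9 ∷ 3 ∷ 10 ∷ 2 ∷ 11 ∷ 1 ∷ 12 ∷ 0 ∷ 13 ∷ 8 ∷ []) ∷
  (7 ∷ 5 ∷ 6 ∷ 9 ∷ 14 ∷ 0 ∷ 13 ∷ 1 ∷ 12 ∷ 2 ∷ 11 ∷ 3 ∷ 10 ∷ 4 ∷ 8 ∷ []) ∷
  (9 ∷ 7 ∷ 6 ∷ 10 ∷ 5 ∷ 12 ∷ 4 ∷ 13 ∷ 3 ∷ 14 ∷ 2 ∷ 15 ∷ 1 ∷ 16 ∷ 0 ∷ 17 ∷ 11 ∷ 8 ∷ []) ∷
  (9 ∷ 6 ∷ 12 ∷ 10 ∷ 5 ∷ 13 ∷ 4 ∷ 14 ∷ 3 ∷ 15 ∷ 2 ∷ 16 ∷ 1 ∷ 17 ∷ 0 ∷ 18 ∷ 11 ∷ 7 ∷ 8 ∷ []) ∷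
  (10 ∷ 13 ∷ 5 ∷ 14 ∷ 4 ∷ 15 ∷ 3 ∷ 16 ∷ 2 ∷ 17 ∷ 1 ∷ 18 ∷ 0 ∷ 19 ∷ 12 ∷ 6 ∷ 11 ∷ 7 ∷ 9 ∷ 8 ∷ []) ∷
  (16 ∷ 14 ∷ 15 ∷ 18 ∷ 23 ∷ 9 ∷ 22 ∷ 10 ∷ 21 ∷ 11 ∷ 20 ∷ 12 ∷ 19 ∷ 13 ∷ 17 ∷ 32 ∷ 0 ∷ 31 ∷ 1 ∷ 30 ∷ 2 ∷ 29 ∷ 3 ∷ 28 ∷ 4 ∷ 27 ∷ 5 ∷ 26 ∷ 6 ∷ 25 ∷ 7 ∷ 24 ∷ 8 ∷ []) ∷
  (17 ∷ 14 ∷ 15 ∷ 19 ∷ 25 ∷ 7 ∷ 26 ∷ 6 ∷ 27 ∷ 5 ∷ 28 ∷ 4 ∷ 29 ∷ 3 ∷ 30 ∷ 2 ∷ 31 ∷ 1 ∷ 32 ∷ 0 ∷ 33 ∷ 16 ∷ 18 ∷ 13 ∷ 20 ∷ 12 ∷ 21 ∷ 11 ∷ 22 ∷ 10 ∷ 23 ∷ 9 ∷ 24 ∷ 8 ∷ []) ∷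
  (17 ∷ 19 ∷ 14 ∷ 18 ∷ 15 ∷ 16 ∷ 34 ∷ 0 ∷ 33 ∷ 1 ∷ 32 ∷ 2 ∷ 31 ∷ 3 ∷ 30 ∷ 4 ∷ 29 ∷ 5 ∷ 28 ∷ 6 ∷ 27 ∷ 7 ∷ 26 ∷ 20 ∷ 13 ∷ 21 ∷ 12 ∷ 22 ∷ 11 ∷ 23 ∷ 10 ∷ 24 ∷ 9 ∷ 25 ∷ 8 ∷ []) ∷
  []
bases 10 =
  (4 ∷ 5 ∷ 3 ∷ 6 ∷ 2 ∷ 7 ∷ 1 ∷ 8 ∷ 0 ∷ 9 ∷ []) ∷
  (6 ∷ 3 ∷ 5 ∷ 4 ∷ 8 ∷ 1 ∷ 7 ∷ 2 ∷ 10 ∷ 0 ∷ 9 ∷ []) ∷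
  (5 ∷ 3 ∷ 6 ∷ 7 ∷ 2 ∷ 8 ∷ 4 ∷ 11 ∷ 0 ∷ 10 ∷ 1 ∷ 9 ∷ []) ∷
  (7 ∷ 3 ∷ 8 ∷ 5 ∷ 4 ∷ 6 ∷ 12 ∷ 0 ∷ 11 ∷ 1 ∷ 10 ∷ 2 ∷ 9 ∷ []) ∷
  (6 ∷ 5 ∷ 7 ∷ 4 ∷ 8 ∷ 13 ∷ 0 ∷ 12 ∷ 1 ∷ 11 ∷ 2 ∷ 10 ∷ 3 ∷ 9 ∷ []) ∷
  (8 ∷ 14 ∷ 0 ∷ 13 ∷ 1 ∷ 12 ∷ 2 ∷ 11 ∷ 3 ∷ 10 ∷ 6 ∷ 5 ∷ 7 ∷ 4 ∷ 9 ∷ []) ∷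
  (7 ∷ 10 ∷ 5 ∷ 6 ∷ 8 ∷ 4 ∷ 11 ∷ 3 ∷ 12 ∷ 2 ∷ 13 ∷ 1 ∷ 14 ∷ 0 ∷ 15 ∷ 9 ∷ []) ∷
  (8 ∷ 11 ∷ 17 ∷ 0 ∷ 16 ∷ 1 ∷ 15 ∷ 2 ∷ 14 ∷ 3 ∷ 13 ∷ 4 ∷ 12 ∷ 5 ∷ 10 ∷ 6 ∷ 7 ∷ 9 ∷ []) ∷
  (10 ∷ 5 ∷ 13 ∷ 4 ∷ 14 ∷ 3 ∷ 15 ∷ 2 ∷ 16 ∷ 1 ∷ 17 ∷ 0 ∷ 18 ∷ 11 ∷ 7 ∷ 8 ∷ 6 ∷ 12 ∷ 9 ∷ []) ∷
  (17 ∷ 20 ∷ 15 ∷ 16 ∷ 18 ∷ 14 ∷ 21 ∷ 13 ∷ 22 ∷ 12 ∷ 23 ∷ 11 ∷ 24 ∷ 10 ∷ 25 ∷ 19 ∷ 35 ∷ 0 ∷ 34 ∷ 1 ∷ 33 ∷ 2 ∷ 32 ∷ 3 ∷ 31 ∷ 4 ∷ 30 ∷ 5 ∷ 29 ∷ 6 ∷ 28 ∷ 7 ∷ 27 ∷ 8 ∷ 26 ∷ 9 ∷ []) ∷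
  (19 ∷ 15 ∷ 20 ∷ 17 ∷ 16 ∷ 18 ∷ 36 ∷ 0 ∷ 35 ∷ 1 ∷ 34 ∷ 2 ∷ 33 ∷ 3 ∷ 32 ∷ 4 ∷ 31 ∷ 5 ∷ 30 ∷ 6 ∷ 29 ∷ 7 ∷ 28 ∷ 8 ∷ 27 ∷ 21 ∷ 14 ∷ 22 ∷ 13 ∷ 23 ∷ 12 ∷ 24 ∷ 11 ∷ 25 ∷ 10 ∷ 26 ∷ 9 ∷ []) ∷
  (20 ∷ 15 ∷ 23 ∷ 14 ∷ 24 ∷ 13 ∷ 25 ∷ 12 ∷ 26 ∷ 11 ∷ 27 ∷ 10 ∷ 28 ∷ 21 ∷ 17 ∷ 18 ∷ 16 ∷ 22 ∷ 19 ∷ 38 ∷ 0 ∷ 37 ∷ 1 ∷ 36 ∷ 2 ∷ 35 ∷ 3 ∷ 34 ∷ 4 ∷ 33 ∷ 5 ∷ 32 ∷ 6 ∷ 31 ∷ 7 ∷ 30 ∷ 8 ∷ 29 ∷ 9 ∷ []) ∷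
  (19 ∷ 17 ∷ 20 ∷ 21 ∷ 16 ∷ 22 ∷ 18 ∷ 39 ∷ 0 ∷ 38 ∷ 1 ∷ 37 ∷ 2 ∷ 36 ∷ 3 ∷ 35 ∷ 4 ∷ 34 ∷ 5 ∷ 33 ∷ 6 ∷ 32 ∷ 7 ∷ 31 ∷ 8 ∷ 30 ∷ 23 ∷ 15 ∷ 24 ∷ 14 ∷ 25 ∷ 13 ∷ 26 ∷ 12 ∷ 27 ∷ 11 ∷ 28 ∷ 10 ∷ 29 ∷ 9 ∷ []) ∷
  []
bases 11 =
  (5 ∷ 4 ∷ 6 ∷ 3 ∷ 7 ∷ 2 ∷ 8 ∷ 1 ∷ 9 ∷ 0 ∷ 10 ∷ []) ∷
  (6 ∷ 3 ∷ 7 ∷ 5 ∷ 4 ∷ 9 ∷ 1 ∷ 8 ∷ 2 ∷ 11 ∷ 0 ∷ 10 ∷ []) ∷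
  (6 ∷ 9 ∷ 2 ∷ 8 ∷ 3 ∷ 7 ∷ 5 ∷ 4 ∷ 12 ∷ 0 ∷ 11 ∷ 1 ∷ 10 ∷ []) ∷
  (7 ∷ 5 ∷ 4 ∷ 8 ∷ 3 ∷ 9 ∷ 6 ∷ 13 ∷ 0 ∷ 12 ∷ 1 ∷ 11 ∷ 2 ∷ 10 ∷ []) ∷
  (7 ∷ 5 ∷ 6 ∷ 9 ∷ 4 ∷ 8 ∷ 14 ∷ 0 ∷ 13 ∷ 1 ∷ 12 ∷ 2 ∷ 11 ∷ 3 ∷ 10 ∷ []) ∷
  (8 ∷ 4 ∷ 11 ∷ 3 ∷ 12 ∷ 2 ∷ 13 ∷ 1 ∷ 14 ∷ 0 ∷ 15 ∷ 9 ∷ 6 ∷ 7 ∷ 5 ∷ 10 ∷ []) ∷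
  (8 ∷ 5 ∷ 9 ∷ 7 ∷ 6 ∷ 11 ∷ 4 ∷ 12 ∷ 3 ∷ 13 ∷ 2 ∷ 14 ∷ 1 ∷ 15 ∷ 0 ∷ 16 ∷ 10 ∷ []) ∷
  (9 ∷ 6 ∷ 8 ∷ 7 ∷ 11 ∷ 17 ∷ 0 ∷ 16 ∷ 1 ∷ 15 ∷ 2 ∷ 14 ∷ 3 ∷ 13 ∷ 4 ∷ 12 ∷ 5 ∷ 10 ∷ []) ∷
  (9 ∷ 12 ∷ 6 ∷ 8 ∷ 7 ∷ 11 ∷ 18 ∷ 0 ∷ 17 ∷ 1 ∷ 16 ∷ 2 ∷ 15 ∷ 3 ∷ 14 ∷ 4 ∷ 13 ∷ 5 ∷ 10 ∷ []) ∷
  (20 ∷ 23 ∷ 17 ∷ 19 ∷ 18 ∷ 22 ∷ 29 ∷ 11 ∷ 28 ∷ 12 ∷ 27 ∷ 13 ∷ 26 ∷ 14 ∷ 25 ∷ 15 ∷ 24 ∷ 16 ∷ 21 ∷ 40 ∷ 0 ∷ 39 ∷ 1 ∷ 38 ∷ 2 ∷ 37 ∷ 3 ∷ 36 ∷ 4 ∷ 35 ∷ 5 ∷ 34 ∷ 6 ∷ 33 ∷ 7 ∷ 32 ∷ 8 ∷ 31 ∷ 9 ∷ 30 ∷ 10 ∷ []) ∷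
  (21 ∷ 19 ∷ 18 ∷ 22 ∷ 17 ∷ 23 ∷ 20 ∷ 41 ∷ 0 ∷ 40 ∷ 1 ∷ 39 ∷ 2 ∷ 38 ∷ 3 ∷ 37 ∷ 4 ∷ 36 ∷ 5 ∷ 35 ∷ 6 ∷ 34 ∷ 7 ∷ 33 ∷ 8 ∷ 32 ∷ 9 ∷ 31 ∷ 24 ∷ 16 ∷ 25 ∷ 15 ∷ 26 ∷ 14 ∷ 27 ∷ 13 ∷ 28 ∷ 12 ∷ 29 ∷ 11 ∷ 30 ∷ 10 ∷ []) ∷
  []
bases 12 =
  (5 ∷ 6 ∷ 4 ∷ 7 ∷ 3 ∷ 8 ∷ 2 ∷ 9 ∷ 1 ∷ 10 ∷ 0 ∷ 11 ∷ []) ∷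
  (7 ∷ 3 ∷ 8 ∷ 5 ∷ 6 ∷ 4 ∷ 10 ∷ 1 ∷ 9 ∷ 2 ∷ 12 ∷ 0 ∷ 11 ∷ []) ∷
  (6 ∷ 5 ∷ 7 ∷ 10 ∷ 2 ∷ 9 ∷ 3 ∷ 8 ∷ 4 ∷ 13 ∷ 0 ∷ 12 ∷ 1 ∷ 11 ∷ []) ∷
  (8 ∷ 4 ∷ 9 ∷ 3 ∷ 10 ∷ 7 ∷ 5 ∷ 6 ∷ 14 ∷ 0 ∷ 13 ∷ 1 ∷ 12 ∷ 2 ∷ 11 ∷ []) ∷
  (7 ∷ 10 ∷ 4 ∷ 9 ∷ 5 ∷ 6 ∷ 8 ∷ 15 ∷ 0 ∷ 14 ∷ 1 ∷ 13 ∷ 2 ∷ 12 ∷ 3 ∷ 11 ∷ []) ∷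
  (9 ∷ 16 ∷ 0 ∷ 15 ∷ 1 ∷ 14 ∷ 2 ∷ 13 ∷ 3 ∷ 12 ∷ 4 ∷ 10 ∷ 5 ∷ 8 ∷ 6 ∷ 7 ∷ 11 ∷ []) ∷
  (8 ∷ 7 ∷ 9 ∷ 6 ∷ 10 ∷ 5 ∷ 12 ∷ 4 ∷ 13 ∷ 3 ∷ 14 ∷ 2 ∷ 15 ∷ 1 ∷ 16 ∷ 0 ∷ 17 ∷ 11 ∷ []) ∷
  (10 ∷ 8 ∷ 7 ∷ 12 ∷ 6 ∷ 9 ∷ 5 ∷ 13 ∷ 4 ∷ 14 ∷ 3 ∷ 15 ∷ 2 ∷ 16 ∷ 1 ∷ 17 ∷ 0 ∷ 18 ∷ 11 ∷ []) ∷
  (9 ∷ 12 ∷ 19 ∷ 0 ∷ 18 ∷ 1 ∷ 17 ∷ 2 ∷ 16 ∷ 3 ∷ 15 ∷ 4 ∷ 14 ∷ 5 ∷ 13 ∷ 7 ∷ 8 ∷ 10 ∷ 6 ∷ 11 ∷ []) ∷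
  []
bases 13 =
  (6 ∷ 5 ∷ 7 ∷ 4 ∷ 8 ∷ 3 ∷ 9 ∷ 2 ∷ 10 ∷ 1 ∷ 11 ∷ 0 ∷ 12 ∷ []) ∷
  (7 ∷ 5 ∷ 6 ∷ 9 ∷ 3 ∷ 8 ∷ 4 ∷ 11 ∷ 1 ∷ 10 ∷ 2 ∷ 13 ∷ 0 ∷ 12 ∷ []) ∷
  (7 ∷ 9 ∷ 3 ∷ 10 ∷ 2 ∷ 11 ∷ 6 ∷ 5 ∷ 8 ∷ 4 ∷ 14 ∷ 0 ∷ 13 ∷ 1 ∷ 12 ∷ []) ∷
  (8 ∷ 11 ∷ 3 ∷ 10 ∷ 4 ∷ 9 ∷ 5 ∷ 7 ∷ 6 ∷ 15 ∷ 0 ∷ 14 ∷ 1 ∷ 13 ∷ 2 ∷ 12 ∷ []) ∷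
  (8 ∷ 6 ∷ 7 ∷ 16 ∷ 0 ∷ 15 ∷ 1 ∷ 14 ∷ 2 ∷ 13 ∷ 3 ∷ 11 ∷ 4 ∷ 10 ∷ 5 ∷ 9 ∷ 12 ∷ []) ∷
  (9 ∷ 6 ∷ 8 ∷ 7 ∷ 11 ∷ 5 ∷ 10 ∷ 17 ∷ 0 ∷ 16 ∷ 1 ∷ 15 ∷ 2 ∷ 14 ∷ 3 ∷ 13 ∷ 4 ∷ 12 ∷ []) ∷
  (9 ∷ 7 ∷ 8 ∷ 11 ∷ 18 ∷ 0 ∷ 17 ∷ 1 ∷ 16 ∷ 2 ∷ 15 ∷ 3 ∷ 14 ∷ 4 ∷ 13 ∷ 5 ∷ 10 ∷ 6 ∷ 12 ∷ []) ∷
  (10 ∷ 6 ∷ 11 ∷ 8 ∷ 9 ∷ 7 ∷ 13 ∷ 5 ∷ 14 ∷ 4 ∷ 15 ∷ 3 ∷ 16 ∷ 2 ∷ 17 ∷ 1 ∷ 18 ∷ 0 ∷ 19 ∷ 12 ∷ []) ∷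
  []
bases 14 =
  (6 ∷ 7 ∷ 5 ∷ 8 ∷ 4 ∷ 9 ∷ 3 ∷ 10 ∷ 2 ∷ 11 ∷ 1 ∷ 12 ∷ 0 ∷ 13 ∷ []) ∷
  (8 ∷ 5 ∷ 7 ∷ 6 ∷ 10 ∷ 3 ∷ 9 ∷ 4 ∷ 12 ∷ 1 ∷ 11 ∷ 2 ∷ 14 ∷ 0 ∷ 13 ∷ []) ∷
  (7 ∷ 6 ∷ 12 ∷ 2 ∷ 11 ∷ 3 ∷ 10 ∷ 8 ∷ 5 ∷ 9 ∷ 4 ∷ 15 ∷ 0 ∷ 14 ∷ 1 ∷ 13 ∷ []) ∷
  (9 ∷ 5 ∷ 8 ∷ 10 ∷ 4 ∷ 11 ∷ 3 ∷ 12 ∷ 7 ∷ 6 ∷ 16 ∷ 0 ∷ 15 ∷ 1 ∷ 14 ∷ 2 ∷ 13 ∷ []) ∷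
  (8 ∷ 10 ∷ 5 ∷ 11 ∷ 4 ∷ 12 ∷ 3 ∷ 14 ∷ 2 ∷ 15 ∷ 1 ∷ 16 ∷ 0 ∷ 17 ∷ 7 ∷ 6 ∷ 9 ∷ 13 ∷ []) ∷
  (10 ∷ 7 ∷ 8 ∷ 6 ∷ 11 ∷ 5 ∷ 12 ∷ 4 ∷ 14 ∷ 3 ∷ 15 ∷ 2 ∷ 16 ∷ 1 ∷ 17 ∷ 0 ∷ 18 ∷ 9 ∷ 13 ∷ []) ∷
  (9 ∷ 8 ∷ 10 ∷ 7 ∷ 11 ∷ 6 ∷ 12 ∷ 19 ∷ 0 ∷ 18 ∷ 1 ∷ 17 ∷ 2 ∷ 16 ∷ 3 ∷ 15 ∷ 4 ∷ 14 ∷ 5 ∷ 13 ∷ []) ∷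
  []
bases 15 =
  (7 ∷ 6 ∷ 8 ∷ 5 ∷ 9 ∷ 4 ∷ 10 ∷ 3 ∷ 11 ∷ 2 ∷ 12 ∷ 1 ∷ 13 ∷ 0 ∷ 14 ∷ []) ∷
  (8 ∷ 5 ∷ 9 ∷ 7 ∷ 6 ∷ 11 ∷ 3 ∷ 10 ∷ 4 ∷ 13 ∷ 1 ∷ 12 ∷ 2 ∷ 15 ∷ 0 ∷ 14 ∷ []) ∷
  (8 ∷ 10 ∷ 5 ∷ 9 ∷ 6 ∷ 7 ∷ 13 ∷ 2 ∷ 12 ∷ 3 ∷ 11 ∷ 4 ∷ 16 ∷ 0 ∷ 15 ∷ 1 ∷ 14 ∷ []) ∷
  (9 ∷ 13 ∷ 3 ∷ 12 ∷ 4 ∷ 11 ∷ 5 ∷ 10 ∷ 7 ∷ 8 ∷ 6 ∷ 17 ∷ 0 ∷ 16 ∷ 1 ∷ 15 ∷ 2 ∷ 14 ∷ []) ∷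
  (9 ∷ 13 ∷ 4 ∷ 12 ∷ 5 ∷ 11 ∷ 6 ∷ 7 ∷ 10 ∷ 8 ∷ 18 ∷ 0 ∷ 17 ∷ 1 ∷ 16 ∷ 2 ∷ 15 ∷ 3 ∷ 14 ∷ []) ∷
  (10 ∷ 8 ∷ 11 ∷ 7 ∷ 6 ∷ 12 ∷ 5 ∷ 13 ∷ 4 ∷ 15 ∷ 3 ∷ 16 ∷ 2 ∷ 17 ∷ 1 ∷ 18 ∷ 0 ∷ 19 ∷ 9 ∷ 14 ∷ []) ∷
  []
bases 16 =
  (7 ∷ 8 ∷ 6 ∷ 9 ∷ 5 ∷ 10 ∷ 4 ∷ 11 ∷ 3 ∷ 12 ∷ 2 ∷ 13 ∷ 1 ∷ 14 ∷ 0 ∷ 15 ∷ []) ∷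
  (9 ∷ 5 ∷ 10 ∷ 7 ∷ 8 ∷ 6 ∷ 12 ∷ 3 ∷ 11 ∷ 4 ∷ 14 ∷ 1 ∷ 13 ∷ 2 ∷ 16 ∷ 0 ∷ 15 ∷ []) ∷
  (8 ∷ 6 ∷ 9 ∷ 10 ∷ 5 ∷ 11 ∷ 7 ∷ 14 ∷ 2 ∷ 13 ∷ 3 ∷ 12 ∷ 4 ∷ 17 ∷ 0 ∷ 16 ∷ 1 ∷ 15 ∷ []) ∷
  (10 ∷ 8 ∷ 7 ∷ 11 ∷ 5 ∷ 12 ∷ 4 ∷ 13 ∷ 3 ∷ 14 ∷ 9 ∷ 6 ∷ 18 ∷ 0 ∷ 17 ∷ 1 ∷ 16 ∷ 2 ∷ 15 ∷ []) ∷
  (9 ∷ 11 ∷ 6 ∷ 12 ∷ 5 ∷ 13 ∷ 4 ∷ 14 ∷ 10 ∷ 7 ∷ 8 ∷ 19 ∷ 0 ∷ 18 ∷ 1 ∷ 17 ∷ 2 ∷ 16 ∷ 3 ∷ 15 ∷ []) ∷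
  []
bases 17 =
  (8 ∷ 7 ∷ 9 ∷ 6 ∷ 10 ∷ 5 ∷ 11 ∷ 4 ∷ 12 ∷ 3 ∷ 13 ∷ 2 ∷ 14 ∷ 1 ∷ 15 ∷ 0 ∷ 16 ∷ []) ∷
  (9 ∷ 7 ∷ 8 ∷ 11 ∷ 5 ∷ 10 ∷ 6 ∷ 13 ∷ 3 ∷ 12 ∷ 4 ∷ 15 ∷ 1 ∷ 14 ∷ 2 ∷ 17 ∷ 0 ∷ 16 ∷ []) ∷
  (9 ∷ 12 ∷ 5 ∷ 11 ∷ 6 ∷ 10 ∷ 8 ∷ 7 ∷ 15 ∷ 2 ∷ 14 ∷ 3 ∷ 13 ∷ 4 ∷ 18 ∷ 0 ∷ 17 ∷ 1 ∷ 16 ∷ []) ∷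
  (10 ∷ 7 ∷ 8 ∷ 12 ∷ 5 ∷ 13 ∷ 4 ∷ 14 ∷ 3 ∷ 15 ∷ 9 ∷ 11 ∷ 6 ∷ 19 ∷ 0 ∷ 18 ∷ 1 ∷ 17 ∷ 2 ∷ 16 ∷ []) ∷
  []
bases 18 =
  (8 ∷ 9 ∷ 7 ∷ 10 ∷ 6 ∷ 11 ∷ 5 ∷ 12 ∷ 4 ∷ 13 ∷ 3 ∷ 14 ∷ 2 ∷ 15 ∷ 1 ∷ 16 ∷ 0 ∷ 17 ∷ []) ∷
  (10 ∷ 7 ∷ 9 ∷ 8 ∷ 12 ∷ 5 ∷ 11 ∷ 6 ∷ 14 ∷ 3 ∷ 13 ∷ 4 ∷ 16 ∷ 1 ∷ 15 ∷ 2 ∷ 18 ∷ 0 ∷ 17 ∷ []) ∷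
  (9 ∷ 8 ∷ 10 ∷ 13 ∷ 5 ∷ 12 ∷ 6 ∷ 11 ∷ 7 ∷ 16 ∷ 2 ∷ 15 ∷ 3 ∷ 14 ∷ 4 ∷ 19 ∷ 0 ∷ 18 ∷ 1 ∷ 17 ∷ []) ∷
  []
bases 19 =
  (9 ∷ 8 ∷ 10 ∷ 7 ∷ 11 ∷ 6 ∷ 12 ∷ 5 ∷ 13 ∷ 4 ∷ 14 ∷ 3 ∷ 15 ∷ 2 ∷ 16 ∷ 1 ∷ 17 ∷ 0 ∷ 18 ∷ []) ∷
  (10 ∷ 7 ∷ 11 ∷ 9 ∷ 8 ∷ 13 ∷ 5 ∷ 12 ∷ 6 ∷ 15 ∷ 3 ∷ 14 ∷ 4 ∷ 17 ∷ 1 ∷ 16 ∷ 2 ∷ 19 ∷ 0 ∷ 18 ∷ []) ∷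
  []
bases 20 =
  (9 ∷ 10 ∷ 8 ∷ 11 ∷ 7 ∷ 12 ∷ 6 ∷ 13 ∷ 5 ∷ 14 ∷ 4 ∷ 15 ∷ 3 ∷ 16 ∷ 2 ∷ 17 ∷ 1 ∷ 18 ∷ 0 ∷ 19 ∷ []) ∷
  []
bases _ = []

-- Phrased with bounded quantifiers and list membership so that `seed?` decides it by evaluation;
-- `take 1 w` reaches the first label without a case distinction on `w`.
Seed : ℕ → List ℕ → Set
Seed k w = (∀ {i} → i < length w → i ∈ w)
         × (∀ {d} → d < pred (length w) → suc d ∈ steps ∣_-_∣ w)
         × All (λ c → suc c ≡ ⌈ length w /2⌉ ⊎ c ≡ ⌈ length w /2⌉) (take 1 w)
         × last w ≡ just (pred k)

seed? : ∀ k → Decidable (Seed k)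
seed? k w = allUpTo? (_∈? w) (length w)
  ×-dec allUpTo? (λ d → suc d ∈? steps ∣_-_∣ w) (pred (length w))
  ×-dec all? (λ c → (suc c ≟ _) ⊎-dec (c ≟ _)) (take 1 w)
  ×-dec Maybe.≡-dec _≟_ (last w) (just (pred k))

bases-seed : ∀ {k} → k < 21 → All (Seed k) (bases k)
bases-seed = from-yes (allUpTo? (λ k → all? (seed? k) (bases k)) 21)

Listed : ℕ → ℕ → Set
Listed k n = Any (λ w → length w ≡ n) (bases k)

listed? : ∀ k n → Dec (Listed k n)
listed? k n = any? (λ w → length w ≟ n) (bases k)

-- If q = 1, then N = p + r and m = 2(p + r) + 1, so the first alternative is impossible and the other two reduce to
-- the cases p = 1 and p = 2.
Exceptional : ℕ → ℕ → Set
Exceptional p r = (p + r) % 2 ≡ 1 ⊎ g (suc r) ≡ g (p + r) ⊎ g (suc r) ≡ g (pred (p + r))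
  where
  g : ℕ → ℕ
  g i = gcd i (suc (2 * (p + r)))

-- The second alternative absorbs one of the q zigzags into the tabulated labelling. For q = 1 no
-- zigzag would remain, hence the extra condition.
Available : ℕ → ℕ → Set
Available p r = Listed ⌈ p /2⌉ r ⊎ Listed ⌈ p /2⌉ (p + r) × Exceptional p r

available? : ∀ p r → Dec (Available p r)
available? p r = listed? ⌈ p /2⌉ r ⊎-dec (listed? ⌈ p /2⌉ (p + r) ×-dec
  (((p + r) % 2 ≟ 1) ⊎-dec (_ ≟ _) ⊎-dec (_ ≟ _)))

-- The bounds p ≤ 2r and r ≤ 20 leave finitely many pairs, so the claim is settled by evaluation; p
-- = 1 is left to a different tour.
available : ∀ {p} → p < 41 → 1 < p → ∀ {r} → r < 21 → ⌈ p /2⌉ ≤ r → Available p r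
available = from-yes (allUpTo? (λ p → (1 <? p) →-dec allUpTo? (λ r → (⌈ p /2⌉ ≤? r) →-dec available? p r) 21) 41)

-- Prolonging a labelling

-- `middle` makes the two junctions of the tour contribute ±N, and `jump` is the difference that
-- disappears with the last vertex.
record Spiral (ℓ δ : ℕ) : Set where
  field
    {start}  : ℕ
    {rest}   : List ℕ
    graceful : Graceful 1 (2 * ℓ) (start ∷ rest)
    middle   : start ≡ ℓ ⊎ start ≡ suc ℓ
    {front}  : List ℕ
    {y z}    : ℕ
    final    : start ∷ rest ≡ front ++ y ∷ z ∷ []
    jump     : ∣ y - z ∣ ≡ δ

⌊2*l+x/2⌋ : ∀ l x → ⌊ l + l + x /2⌋ ≡ l + ⌊ x /2⌋
⌊2*l+x/2⌋ zero    x = refl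
⌊2*l+x/2⌋ (suc l) x = trans (cong (λ y → ⌊ suc y + x /2⌋) (+-suc l l)) (cong suc (⌊2*l+x/2⌋ l x))

module Tower (p′ : ℕ) {k r : ℕ} (k≡ : ⌈ suc p′ /2⌉ ≡ suc k)
             {c : ℕ} {w : List ℕ} (size : length (c ∷ w) ≡ r) (seed : Seed (suc k) (c ∷ w)) where

  p : ℕ
  p = suc p′

  -- The side where the zigzag of the next round starts. The seed ends at the `suc k`-th place from
  -- below, so the first zigzag starts from above.
  side : ℕ → Side
  side zero    = high
  side (suc q) = next (side q) p

  width : ℕ → ℕ
  width zero    = r
  width (suc q) = p + width q

  tower : ℕ → ℕ → List ℕ
  tower zero    a = map (a +_) (c ∷ w)
  tower (suc q) a = tower q (off (side q) p a) ++ zig (side q) p a (width q)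

  offset : ℕ → ℕ
  offset zero    = 0
  offset (suc q) = lows (side q) p + offset q

  width≡ : ∀ q → width q ≡ q * p + r
  width≡ zero    = refl
  width≡ (suc q) = trans (cong (p +_) (width≡ q)) (sym (+-assoc p (q * p) r))

  -- Summing `balance` over the rounds shows that the seed stays in the centre of the interval, up
  -- to the parity recorded by `bal`.
  offset-balance : ∀ q → offset q + offset q + (bal (side q) + r) ≡ width q
  offset-balance zero    = refl
  offset-balance (suc q) = begin
    l + s + (l + s) + (bal (next (side q) p) + r)  ≡⟨ lemma₁ l s (bal (next (side q) p)) r ⟩
    l + l + bal (next (side q) p) + (s + s + r)    ≡⟨ cong (_+ (s + s + r)) (balance (side q) p) ⟩
    p + bal (side q) + (s + s + r)                 ≡⟨ lemma₂ p s (bal (side q)) r ⟩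
    p + (s + s + (bal (side q) + r))               ≡⟨ cong (p +_) (offset-balance q) ⟩
    p + width q                                    ∎
    where
    open ≡-Reasoning
    l = lows (side q) p
    s = offset q
    lemma₁ : ∀ l s b r → l + s + (l + s) + (b + r) ≡ l + l + b + (s + s + r)
    lemma₁ = solve-∀
    lemma₂ : ∀ p s b r → p + b + (s + s + r) ≡ p + (s + s + (b + r))
    lemma₂ = solve-∀

  tower-head : ∀ q a → ∃ λ t → tower q a ≡ offset q + a + c ∷ t
  tower-head zero    a = _ , refl
  tower-head (suc q) a with tower-head q (off (side q) p a)
  ... | t , eq = _ , trans (cong (_++ zig (side q) p a (width q)) eq) (cong (λ h → h + c ∷ t ++ zig (side q) p a (width q))
    (trans (cong (offset q +_) (off-lows (side q) p a)) (lemma (offset q) (lows (side q) p) a)))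
    where
    lemma : ∀ s l a → s + (l + a) ≡ l + s + a
    lemma = solve-∀

  base-graceful : ∀ a → Graceful a r (map (a +_) (c ∷ w))
  base-graceful a = record
    { size   = trans (length-map (a +_) (c ∷ w)) size
    ; covers = λ {x} a≤x x< → subst (_∈ map (a +_) (c ∷ w)) (m+[n∸m]≡n a≤x)
        (∈-map⁺ (a +_) (proj₁ seed (subst (x ∸ a <_) (sym size)
          (+-cancelˡ-< a (x ∸ a) r (subst (_< a + r) (sym (m+[n∸m]≡n a≤x)) x<)))))
    ; jumps  = jmp
    }
    where
    jmp : ∀ {d} → 0 < d → d < r → ∃₂ λ x y → Adjacent x y (map (a +_) (c ∷ w)) × ∣ x - y ∣ ≡ d
    jmp {suc d} _ d< with adj-steps⁻ ∣_-_∣ (c ∷ w)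
      (proj₁ (proj₂ seed) (subst (λ n → suc d ≤ pred n) (sym size) (pred-mono-≤ d<)))
    ... | x , y , q , eq = a + x , a + y , adj-map (a +_) q , trans (∣m+n-m+o∣≡∣n-o∣ a x y) eq

  -- The invariant that lets the rounds repeat: by `depth-end` and `leave`, a zigzag ends at the
  -- place from which `depth-start` and `enter` can begin the next one.
  tower-end : ∀ q a → ∃₂ λ l z → tower q a ≡ l ∷ʳ z × End (side q) (suc k) z a (width q)
  tower-end zero a with last⇒∷ʳ (c ∷ w) (proj₂ (proj₂ (proj₂ seed)))
  ... | l , eq = map (a +_) l , a + k , trans (cong (map (a +_)) eq) (map-++ (a +_) l (k ∷ []))
               , sym (+-suc a k)
  tower-end (suc q) a with zig-end (opp (side q)) p′ (outside-first (side q) a (p′ + width q))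
  ... | l , z , eq , o = tower q (off (side q) p a) ++ l , z
    , trans (cong (tower q (off (side q) p a) ++_) eq) (sym (++-assoc (tower q (off (side q) p a)) l (z ∷ [])))
    , leave (side q) p (next (side q) p) (subst (λ k → Depth (side q) p k (opp (next (side q) p))) k≡ (depth-end (side q) p)) o

  tower-graceful : ∀ q a → Graceful a (width q) (tower q a)
  tower-graceful zero    a = base-graceful a
  tower-graceful (suc q) a with tower-end q (off (side q) p a)
  ... | l , z , eq , e = extend (side q) p′
    (subst (λ k → Depth (side q) p k (side q)) k≡ (depth-start (side q) p)) eq e (tower-graceful q _)

  tower-middle : ∀ q {ℓ} → width q ≡ 2 * ℓ → offset q + 1 + c ≡ ℓ ⊎ offset q + 1 + c ≡ suc ℓ
  tower-middle q {ℓ} w≡ = Sum.map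
    (λ e → trans (trans (lemma (offset q) c) (cong (offset q +_) e)) (sym ℓ≡))
    (λ e → trans (lemma (offset q) c) (trans (+-suc (offset q) c) (cong suc (trans (cong (offset q +_) e) (sym ℓ≡)))))
    (subst (λ n → suc c ≡ ⌈ n /2⌉ ⊎ c ≡ ⌈ n /2⌉) size (All.head (proj₁ (proj₂ (proj₂ seed)))))
    where
    lemma : ∀ s c → s + 1 + c ≡ s + suc c
    lemma = solve-∀
    dbl : ℓ + ℓ ≡ offset q + offset q + (bal (side q) + r)
    dbl = trans (cong (ℓ +_) (sym (+-identityʳ ℓ))) (trans (sym w≡) (sym (offset-balance q)))
    ℓ≡ : ℓ ≡ offset q + ⌈ r /2⌉
    -- Twice `ℓ` is twice `offset q` plus `r`, and one more at a low side. Rounded halving, after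
    -- adding 1 in the high case, gives `⌊ suc r /2⌋` both times, which is `⌈ r /2⌉` by definition.
    ℓ≡ with side q | dbl
    ... | low  | e = trans (sym (trans (⌊2*l+x/2⌋ ℓ 0) (+-identityʳ ℓ)))
      (trans (cong ⌊_/2⌋ (trans (+-identityʳ _) e)) (⌊2*l+x/2⌋ (offset q) (suc r)))
    ... | high | e = trans (sym (trans (⌊2*l+x/2⌋ ℓ 1) (+-identityʳ ℓ)))
      (trans (cong ⌊_/2⌋ (trans (cong (_+ 1) e) (lemma′ (offset q) r))) (⌊2*l+x/2⌋ (offset q) (suc r)))
      where
      lemma′ : ∀ s r → s + s + r + 1 ≡ s + s + suc r
      lemma′ = solve-∀

-- The zigzags have at least two labels, so that the last jump lies inside the outermost one; by
-- `zig-last` it exceeds by one the number of labels enclosed.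
spiral : ∀ p q r ℓ → 0 < q → 2 * ℓ ≡ q * suc (suc p) + r → suc (suc p) < 41 →
         Listed ⌈ suc (suc p) /2⌉ r → Spiral ℓ (suc (2 * ℓ ∸ suc (suc p)))
spiral p (suc q) r ℓ 0<q 2ℓ≡ p< listed = go (Any.lookup listed)
  (All.lookupAny (bases-seed (s≤s (⌈n/2⌉-mono (s≤s⁻¹ p<)))) listed)
  where
  go : ∀ w → Seed ⌈ suc (suc p) /2⌉ w × length w ≡ r → Spiral ℓ (suc (2 * ℓ ∸ suc (suc p)))
  go []      ((_ , _ , _ , ()) , _)
  go (c ∷ w) (seed , size) =
    let l , u , v , eq′ , j = zig-last (opp τ) p (outside-first τ 1 (suc p + T.width q))
    in record
      { graceful = subst₂ (Graceful 1) (sym 2ℓ≡′) eq (T.tower-graceful (suc q) 1)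
      ; middle   = T.tower-middle (suc q) (sym 2ℓ≡′)
      ; final    = trans (sym eq) (trans (cong (inner ++_) eq′) (sym (++-assoc inner l _)))
      ; jump     = trans j (cong suc (sym (trans (cong (_∸ suc (suc p)) 2ℓ≡′) (m+n∸m≡n (suc (suc p)) (T.width q)))))
      }
    where
    module T = Tower (suc p) refl size seed
    τ     = T.side q
    inner = T.tower q (off τ (suc (suc p)) 1)
    eq    = proj₂ (T.tower-head (suc q) 1)
    2ℓ≡′ : 2 * ℓ ≡ T.width (suc q)
    2ℓ≡′ = trans 2ℓ≡ (sym (T.width≡ (suc q)))

-- Paths in dihedral groups

module DihedralPaths (m : ℕ) .{{_ : NonZero m}} where

  open Cyclic m
  module D = Group (Dihedral m)
  private module Dₚ = GroupProperties (Dihedral m)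

  quot : D.Carrier → D.Carrier → D.Carrier
  quot g h = g D.⁻¹ D.∙ h

  quot-∙ : ∀ a g h → quot a g D.∙ quot g h ≡ quot a h
  quot-∙ a g h = trans (D.assoc (a D.⁻¹) g (quot g h)) (cong (a D.⁻¹ D.∙_) (Dₚ.\\-leftDividesˡ g h))

  -- The products telescope to the left translate of the path by the inverse of `a`, so distinct
  -- vertices give distinct partial products.
  partialProducts-steps : ∀ a g gs →
    scanl D._∙_ (quot a g) (stepsFrom quot g gs) ≡ map (quot a) (g ∷ gs)
  partialProducts-steps a g []       = refl
  partialProducts-steps a g (h ∷ gs) = cong (quot a g ∷_)
    (trans (cong (λ x → scanl D._∙_ x (stepsFrom quot h gs)) (quot-∙ a g h)) (partialProducts-steps a h gs))

  ⟦_⟧ : ℕ → Fin m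
  ⟦ n ⟧ = n mod m

  elements : List D.Carrier
  elements = map (_, false) (allFin m) ++ map (_, true) (allFin m)

  elements-unique : Unique elements
  elements-unique = Uniqueₚ.++⁺ (Uniqueₚ.map⁺ (cong proj₁) (Uniqueₚ.allFin⁺ m))
    (Uniqueₚ.map⁺ (cong proj₁) (Uniqueₚ.allFin⁺ m)) λ (p , q) → disjoint (∈-map⁻ _ p) (∈-map⁻ _ q)
    where
    disjoint : ∀ {g : D.Carrier} → ∃ (λ i → i ∈ allFin m × g ≡ (i , false)) → ∃ (λ i → i ∈ allFin m × g ≡ (i , true)) → ⊥
    disjoint (_ , _ , refl) (_ , _ , ())

  length-elements : length elements ≡ m + m
  length-elements = trans (length-++ (map (_, false) (allFin m)))
    (cong₂ _+_ (l false) (l true))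
    where
    l : ∀ s → length (map (_, s) (allFin m)) ≡ m
    l s = trans (length-map (_, s) (allFin m)) (length-tabulate {n = m} (λ i → i))

  covering⇒unique : ∀ {gs} → (∀ g → g ∈ gs) → length gs ≡ m + m → Unique gs
  covering⇒unique cov len = unique-resp-↭
    (↭-sym (unique-⊆⇒↭ elements-unique (λ _ → cov _) (trans len (sym length-elements)))) elements-unique

  -- By counting, neither the path nor the sequence of its quotients has repetitions.
  record Avoids (x : D.Carrier) : Set where
    field
      path   : List D.Carrier
      omit   : D.Carrier
      covers : ∀ g → g ∈ path ∷ʳ omit
      size   : suc (length path) ≡ m + m
      used   : ∀ {g} → g ≢ D.ε → g ≢ x → ∃₂ λ p q → Adjacent p q path × quot p q ≡ g

  -- The path has 2m - 1 vertices, hence 2m - 2 quotients, as many as `S` has elements. Since all of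
  -- `S` is among them, they form a permutation of `S`.
  avoids⇒sequencing : ∀ {x} → Avoids x → ∀ S → Unique S → D.ε ∉ S → x ∉ S → 2 + length S ≡ m + m →
                      HasSequencing (Dihedral m) S
  avoids⇒sequencing {x} av S uS ε∉ x∉ len = steps quot path
    , ↭⇒↭ₛ (unique-⊆⇒↭ uS S⊆ (trans (length-steps quot path)
        (cong pred (suc-injective (trans size (sym len))))))
    , unique path uniq (suc-injective (trans size (sym len)))
    where
    open Avoids av
    S⊆ : ∀ {z} → z ∈ S → z ∈ steps quot path
    S⊆ {z} z∈ with used {z} (λ { refl → ε∉ z∈ }) (λ { refl → x∉ z∈ })
    ... | p , q , adj , eq = subst (_∈ steps quot path) eq (adj-steps⁺ quot adj)
    uniq : Unique path
    uniq = unique-++⁻ˡ path (covering⇒unique covers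
      (trans (length-++ path) (trans (+-comm (length path) 1) size)))
    unique : ∀ path → Unique path → length path ≡ suc (length S) →
             Unique (partialProducts (Dihedral m) (steps quot path))
    unique (g ∷ gs) u _ = subst Unique (sym (trans
      (cong (λ e → scanl D._∙_ e (stepsFrom quot g gs)) (sym (D.inverseˡ g))) (partialProducts-steps g g gs)))
      (Uniqueₚ.map⁺ (Dₚ.∙-cancelˡ (g D.⁻¹) _ _) u)

-- Signed residues, and the quotients along stairs and graceful paths.

module Paths (ℓ : ℕ) where

  m N : ℕ
  m = 1 + 4 * ℓ
  N = 2 * ℓ

  open Cyclic m
  open DihedralPaths m
  private module Aₚ = AbelianGroupProperties abelianGroup

  m≡1+N+N : m ≡ suc (N + N)
  m≡1+N+N = cong suc (lemma ℓ)
    where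
    lemma : ∀ l → 4 * l ≡ 2 * l + 2 * l
    lemma = solve-∀

  ℓ+ℓ≡N : ℓ + ℓ ≡ N
  ℓ+ℓ≡N = cong (ℓ +_) (sym (+-identityʳ ℓ))

  difference : ∀ x e → ⊖ ⟦ x ⟧ ⊕ ⟦ x + e ⟧ ≡ ⟦ e ⟧
  difference x e = trans (cong (⊖ ⟦ x ⟧ ⊕_) (sym (mod-⊕-mod x e))) (Aₚ.\\-leftDividesʳ ⟦ x ⟧ ⟦ e ⟧)

  difference⁻ : ∀ x e → ⊖ ⟦ x + e ⟧ ⊕ ⟦ x ⟧ ≡ ⊖ ⟦ e ⟧
  difference⁻ x e = begin
    ⊖ ⟦ x + e ⟧ ⊕ ⟦ x ⟧           ≡⟨ cong (⊖ ⟦ x + e ⟧ ⊕_) (Aₚ.⁻¹-involutive ⟦ x ⟧) ⟨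
    ⊖ ⟦ x + e ⟧ ⊕ ⊖ (⊖ ⟦ x ⟧)     ≡⟨ Aₚ.⁻¹-anti-homo-∙ (⊖ ⟦ x ⟧) ⟦ x + e ⟧ ⟨
    ⊖ (⊖ ⟦ x ⟧ ⊕ ⟦ x + e ⟧)       ≡⟨ cong ⊖_ (difference x e) ⟩
    ⊖ ⟦ e ⟧                       ∎
    where open ≡-Reasoning

  translate : ∀ s x y → ⊖ ⟦ s + x ⟧ ⊕ ⟦ s + y ⟧ ≡ ⊖ ⟦ x ⟧ ⊕ ⟦ y ⟧
  translate s x y = begin
    ⊖ ⟦ s + x ⟧ ⊕ ⟦ s + y ⟧               ≡⟨ cong₂ (λ i j → ⊖ i ⊕ j) (mod-⊕-mod s x) (mod-⊕-mod s y) ⟨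
    ⊖ (⟦ s ⟧ ⊕ ⟦ x ⟧) ⊕ (⟦ s ⟧ ⊕ ⟦ y ⟧)   ≡⟨ cong (_⊕ (⟦ s ⟧ ⊕ ⟦ y ⟧)) (Aₚ.⁻¹-anti-homo-∙ ⟦ s ⟧ ⟦ x ⟧) ⟩
    ⊖ ⟦ x ⟧ ⊕ ⊖ ⟦ s ⟧ ⊕ (⟦ s ⟧ ⊕ ⟦ y ⟧)   ≡⟨ ⊕-assoc (⊖ ⟦ x ⟧) (⊖ ⟦ s ⟧) _ ⟩
    ⊖ ⟦ x ⟧ ⊕ (⊖ ⟦ s ⟧ ⊕ (⟦ s ⟧ ⊕ ⟦ y ⟧)) ≡⟨ cong (⊖ ⟦ x ⟧ ⊕_) (Aₚ.\\-leftDividesʳ ⟦ s ⟧ ⟦ y ⟧) ⟩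
    ⊖ ⟦ x ⟧ ⊕ ⟦ y ⟧                       ∎
    where open ≡-Reasoning

  -- Traversing a pair in the two directions gives opposite residues; the order of `x` and `y`
  -- decides which is which.
  differences : ∀ {x y d} → ∣ x - y ∣ ≡ d →
                (⊖ ⟦ x ⟧ ⊕ ⟦ y ⟧ ≡ ⟦ d ⟧ × ⊖ ⟦ y ⟧ ⊕ ⟦ x ⟧ ≡ ⊖ ⟦ d ⟧) ⊎
                (⊖ ⟦ x ⟧ ⊕ ⟦ y ⟧ ≡ ⊖ ⟦ d ⟧ × ⊖ ⟦ y ⟧ ⊕ ⟦ x ⟧ ≡ ⟦ d ⟧)
  differences {x} {y} refl with ≤-total x y
  ... | inj₁ x≤y with m≤n⇒∃[o]m+o≡n x≤y
  ...   | e , refl rewrite ∣m-m+n∣≡n x e = inj₁ (difference x e , difference⁻ x e)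
  differences {x} {y} refl | inj₂ y≤x with m≤n⇒∃[o]m+o≡n y≤x
  ...   | e , refl rewrite ∣-∣-comm (y + e) y | ∣m-m+n∣≡n y e = inj₂ (difference⁻ y e , difference y e)

  complement : ∀ a b → a + b ≡ m → ⟦ a ⟧ ≡ ⊖ ⟦ b ⟧
  complement a b eq = Aₚ.inverseˡ-unique ⟦ a ⟧ ⟦ b ⟧ (trans (mod-⊕-mod a b) (trans (cong ⟦_⟧ eq) m-mod))

  data Residue : Fin m → Set where
    plus  : ∀ {a} → a ≤ N → Residue ⟦ a ⟧
    minus : ∀ {a} → 0 < a → a ≤ N → Residue (⊖ ⟦ a ⟧)

  residue : ∀ i → Residue i
  residue i with toℕ i ≤? N
  ... | yes i≤ = subst Residue (mod-toℕ i) (plus i≤)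
  ... | no  i≰ = subst Residue (trans (sym (complement (toℕ i) (m ∸ toℕ i) (m+[n∸m]≡n (<⇒≤ (toℕ<n i))))) (mod-toℕ i))
    (minus (m<n⇒0<n∸m (toℕ<n i)) (m≤n+o⇒m∸n≤o m (toℕ i) (subst (_≤ toℕ i + N) (sym m≡1+N+N) (+-monoˡ-≤ N (≰⇒> i≰)))))

  -- The shift `s` brings the labels to 1, ..., N: it is 0 for labels starting at 1 and 1 for labels
  -- starting at 0.
  rot : ℕ → ℕ → D.Carrier
  rot s w = ⟦ s + w ⟧ , false

  rot⁻ ref ref⁻ : ℕ → D.Carrier
  rot⁻ w = ⊖ ⟦ w ⟧ , false
  ref  w = ⟦ w ⟧ , true
  ref⁻ w = ⊖ ⟦ w ⟧ , true

  Occurs : D.Carrier → List D.Carrier → Set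
  Occurs g l = ∃₂ λ p q → Adjacent p q l × quot p q ≡ g

  occurs-++ˡ : ∀ {g l l′} → Occurs g l → Occurs g (l ++ l′)
  occurs-++ˡ (p , q , adj , eq) = p , q , adj-++ˡ adj , eq

  occurs-++ʳ : ∀ {g} l {l′} → Occurs g l′ → Occurs g (l ++ l′)
  occurs-++ʳ l (p , q , adj , eq) = p , q , adj-++ʳ l adj , eq

  quot-rot⁻-ref : ∀ i j → quot (rot⁻ i) (ref j) ≡ (⟦ i + j ⟧ , true)
  quot-rot⁻-ref i j = cong (_, true) (trans (cong (_⊕ ⟦ j ⟧) (Aₚ.⁻¹-involutive ⟦ i ⟧)) (mod-⊕-mod i j))

  quot-ref-rot⁻ : ∀ j i → quot (ref j) (rot⁻ i) ≡ (⟦ j + i ⟧ , true)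
  quot-ref-rot⁻ j i = cong (_, true) (trans (cong (⟦ j ⟧ ⊕_) (Aₚ.⁻¹-involutive ⟦ i ⟧)) (mod-⊕-mod j i))

  stair : ℕ → ℕ → ℕ → List D.Carrier
  stair b c zero    = []
  stair b c (suc j) = rot⁻ (b + j) ∷ ref (c + j) ∷ stair b c j

  length-stair : ∀ b c j → length (stair b c j) ≡ j + j
  length-stair b c zero    = refl
  length-stair b c (suc j) = cong suc (trans (cong suc (length-stair b c j)) (sym (+-suc j j)))

  rot⁻∈stair : ∀ b c j {i} → i < j → rot⁻ (b + i) ∈ stair b c j
  rot⁻∈stair b c (suc j) i< with m<1+n⇒m<n∨m≡n i<
  ... | inj₁ i<j  = there (there (rot⁻∈stair b c j i<j))
  ... | inj₂ refl = here refl

  ref∈stair : ∀ b c j {i} → i < j → ref (c + i) ∈ stair b c j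
  ref∈stair b c (suc j) i< with m<1+n⇒m<n∨m≡n i<
  ... | inj₁ i<j  = there (there (ref∈stair b c j i<j))
  ... | inj₂ refl = there (here refl)

  stair-end : ∀ b c j → ∃ λ l → stair b c (suc j) ≡ l ∷ʳ ref c
  stair-end b c zero = rot⁻ (b + 0) ∷ [] , cong (λ x → rot⁻ (b + 0) ∷ ref x ∷ []) (+-identityʳ c)
  stair-end b c (suc j) with stair-end b c j
  ... | l , eq = rot⁻ (b + suc j) ∷ ref (c + suc j) ∷ l , cong (λ t → rot⁻ (b + suc j) ∷ ref (c + suc j) ∷ t) eq

  -- The rotation -i and the reflection j have the reflection i + j as quotient in either order.
  -- Lowering the two indices alternately therefore yields reflections with consecutive indices;
  -- `stair-rest` handles all below the top one.
  stair-quotients : ∀ b c j {e} → suc e < j + j → Occurs (⟦ b + c + e ⟧ , true) (stair b c j)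
  stair-rest      : ∀ b c j {e} → e < j + j → Occurs (⟦ b + c + e ⟧ , true) (stair b c (suc j))
  stair-quotients b c (suc j) {e} e< = [ stair-rest b c j , (λ { refl → _ , _ , here , top }) ]′
    (m<1+n⇒m<n∨m≡n (s≤s⁻¹ (subst (suc e <_) (+-suc (suc j) j) e<)))
    where
    lemma : ∀ b c j → b + j + (c + j) ≡ b + c + (j + j)
    lemma = solve-∀
    top : quot (rot⁻ (b + j)) (ref (c + j)) ≡ (⟦ b + c + (j + j) ⟧ , true)
    top = trans (quot-rot⁻-ref (b + j) (c + j)) (cong (λ n → ⟦ n ⟧ , true) (lemma b c j))
  stair-rest b c (suc j) e< = [ (λ e<′ → occurs-++ʳ (rot⁻ (b + suc j) ∷ ref (c + suc j) ∷ []) (stair-quotients b c (suc j) (s<s e<′)))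
    , (λ { refl → _ , _ , there here , top }) ]′ (m<1+n⇒m<n∨m≡n e<)
    where
    lemma : ∀ b c j → c + suc j + (b + j) ≡ b + c + (j + suc j)
    lemma = solve-∀
    top : quot (ref (c + suc j)) (rot⁻ (b + j)) ≡ (⟦ b + c + (j + suc j) ⟧ , true)
    top = trans (quot-ref-rot⁻ (c + suc j) (b + j)) (cong (λ n → ⟦ n ⟧ , true) (lemma b c j))

  -- The rotations traverse `w` backwards and the reflections forwards, so one pair of labels at
  -- distance `d` gives both signs, one in each half.
  graceful-quotients : ∀ {a n w} → Graceful a n w → ∀ s {d} → 0 < d → d < n →
    let rots = reverse (map (rot s) w)
        refs = map ref⁻ w
    in (Occurs (⟦ d ⟧ , false) rots ⊎ Occurs (⟦ d ⟧ , false) refs) ×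
       (Occurs (⊖ ⟦ d ⟧ , false) rots ⊎ Occurs (⊖ ⟦ d ⟧ , false) refs)
  graceful-quotients {w = w} G s {d} 0<d d<n with Graceful.jumps G 0<d d<n
  ... | x , y , adj , eq = pick (differences {x} {y} eq)
    where
    back : ∀ {z} → ⊖ ⟦ y ⟧ ⊕ ⟦ x ⟧ ≡ z → Occurs (z , false) (reverse (map (rot s) w))
    back e = _ , _ , adj-reverse (adj-map (rot s) adj) , cong (_, false) (trans (translate s y x) e)
    forth : ∀ {z} → ⊖ ⟦ x ⟧ ⊕ ⟦ y ⟧ ≡ z → Occurs (z , false) (map ref⁻ w)
    forth e = _ , _ , adj-map ref⁻ adj , cong (_, false) (trans (cong (⊖ ⟦ x ⟧ ⊕_) (Aₚ.⁻¹-involutive ⟦ y ⟧)) e)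
    pick : _ ⊎ _ → _
    pick (inj₁ (e , e′)) = inj₂ (forth e) , inj₁ (back e′)
    pick (inj₂ (e , e′)) = inj₁ (back e′) , inj₂ (forth e)

-- The two tours of the dihedral group.

module Constructions (ℓ′ : ℕ) where

  ℓ : ℕ
  ℓ = suc ℓ′

  open Paths ℓ
  open Cyclic m
  open DihedralPaths m
  private module Aₚ = AbelianGroupProperties abelianGroup

  ⟦⟧≡⊖⟦⟧ : ∀ a b → a + b ≡ suc (N + N) → ⟦ a ⟧ ≡ ⊖ ⟦ b ⟧
  ⟦⟧≡⊖⟦⟧ a b eq = complement a b (trans eq (sym m≡1+N+N))

  quot-rot-rot⁻ : ∀ x y → quot (rot 0 x) (rot⁻ y) ≡ (⊖ ⟦ x + y ⟧ , false)
  quot-rot-rot⁻ x y = cong (_, false) (trans (Aₚ.⁻¹-∙-comm ⟦ x ⟧ ⟦ y ⟧) (cong ⊖_ (mod-⊕-mod x y)))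

  quot-ref-ref⁻ : ∀ x y → quot (ref x) (ref⁻ y) ≡ (⟦ x + y ⟧ , false)
  quot-ref-ref⁻ x y = cong (_, false) (trans (cong (⟦ x ⟧ ⊕_) (Aₚ.⁻¹-involutive ⟦ y ⟧)) (mod-⊕-mod x y))

  rotations : ∀ s {a w x} → Graceful a N w → a ≤ x → x < a + N → rot s x ∈ reverse (map (rot s) w)
  rotations s G a≤x x< = Anyₚ.reverse⁺ (∈-map⁺ (rot s) (Graceful.covers G a≤x x<))

  module FromSpiral {δ : ℕ} (spiral : Spiral ℓ δ) where

    open Spiral spiral

    -- The first stair gives the reflections 1, ..., N - 1 and the second N + 1, ..., 2N - 1; the
    -- links through `rot⁻ 0` and `ref N` give 0, N and 2N. The ladder runs from `rot⁻ ℓ` to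
    -- `ref ℓ`, which fixes the quotients at its two junctions.
    ladder descent tour : List D.Carrier
    ladder  = stair 1 0 ℓ ++ rot⁻ 0 ∷ ref N ∷ stair (suc ℓ) ℓ ℓ
    descent = map ref⁻ (start ∷ rest)
    tour    = reverse (map (rot 0) (start ∷ rest)) ++ ladder ++ descent

    ascent = reverse (map (rot 0) (start ∷ rest))

    in-ladder : ∀ {g} → g ∈ ladder → g ∈ tour
    in-ladder g∈ = ∈-++⁺ʳ ascent (∈-++⁺ˡ g∈)

    in-descent : ∀ {a} → 0 < a → a ≤ N → ref⁻ a ∈ tour
    in-descent 0<a a≤ = ∈-++⁺ʳ ascent (∈-++⁺ʳ ladder (∈-map⁺ ref⁻ (Graceful.covers graceful 0<a (s≤s a≤))))

    rot⁻∈ladder : ∀ a → a ≤ N → rot⁻ a ∈ ladder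
    rot⁻∈ladder zero    _  = ∈-++⁺ʳ (stair 1 0 ℓ) (here refl)
    rot⁻∈ladder (suc a) a≤ with a <? ℓ
    ... | yes a<ℓ = ∈-++⁺ˡ (rot⁻∈stair 1 0 ℓ a<ℓ)
    ... | no  a≮ℓ with m≤n⇒∃[o]m+o≡n (≮⇒≥ a≮ℓ)
    ...   | i , refl = ∈-++⁺ʳ (stair 1 0 ℓ) (there (there
      (rot⁻∈stair (suc ℓ) ℓ ℓ (+-cancelˡ-< ℓ i ℓ (subst (ℓ + i <_) (sym ℓ+ℓ≡N) a≤)))))

    ref∈ladder : ∀ a → a ≤ N → ref a ∈ ladder
    ref∈ladder a a≤ with a <? ℓ | m≤n⇒m<n∨m≡n a≤
    ... | yes a<ℓ | _         = ∈-++⁺ˡ (ref∈stair 1 0 ℓ a<ℓ)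
    ... | no  _   | inj₂ refl = ∈-++⁺ʳ (stair 1 0 ℓ) (there (here refl))
    ... | no  a≮ℓ | inj₁ a<N with m≤n⇒∃[o]m+o≡n (≮⇒≥ a≮ℓ)
    ...   | i , refl = ∈-++⁺ʳ (stair 1 0 ℓ) (there (there
      (ref∈stair (suc ℓ) ℓ ℓ (+-cancelˡ-< ℓ i ℓ (subst (ℓ + i <_) (sym ℓ+ℓ≡N) a<N)))))

    tour-covers : ∀ g → g ∈ tour
    tour-covers (i , false) with residue i
    ... | plus {zero}  _   = subst (λ j → (j , false) ∈ tour) Aₚ.ε⁻¹≈ε (in-ladder (rot⁻∈ladder 0 z≤n))
    ... | plus {suc a} a≤  = ∈-++⁺ˡ (rotations 0 graceful (s≤s z≤n) (s≤s a≤))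
    ... | minus {a} _ a≤   = in-ladder (rot⁻∈ladder a a≤)
    tour-covers (i , true) with residue i
    ... | plus {a} a≤      = in-ladder (ref∈ladder a a≤)
    ... | minus {a} 0<a a≤ = in-descent 0<a a≤

    length-tour : length tour ≡ m + m
    length-tour = begin
      length tour                                                ≡⟨ length-++ ascent ⟩
      length ascent + length (ladder ++ descent)                 ≡⟨ cong₂ _+_ l₁ (trans (length-++ ladder) (cong₂ _+_ l₂ l₃)) ⟩
      N + (ℓ + ℓ + suc (suc (ℓ + ℓ)) + N)                        ≡⟨ lemma ℓ ⟩
      m + m                                                      ∎
      where
      open ≡-Reasoning
      l₁ : length ascent ≡ N
      l₁ = trans (length-reverse (map (rot 0) (start ∷ rest))) (trans (length-map (rot 0) (start ∷ rest)) (Graceful.size graceful))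
      l₂ : length ladder ≡ ℓ + ℓ + suc (suc (ℓ + ℓ))
      l₂ = trans (length-++ (stair 1 0 ℓ)) (cong₂ _+_ (length-stair 1 0 ℓ) (cong (2 +_) (length-stair (suc ℓ) ℓ ℓ)))
      l₃ : length descent ≡ N
      l₃ = trans (length-map ref⁻ (start ∷ rest)) (Graceful.size graceful)
      lemma : ∀ l → 2 * l + (l + l + suc (suc (l + l)) + 2 * l) ≡ 1 + 4 * l + (1 + 4 * l)
      lemma = solve-∀

    entry : Occurs (⊖ ⟦ start + ℓ ⟧ , false) tour
    entry = rot 0 start , rot⁻ ℓ
      , subst (λ r → Adjacent (rot 0 start) (rot⁻ ℓ) (r ++ ladder ++ descent))
          (sym (unfold-reverse (rot 0 start) (map (rot 0) rest)))
          (adj-link (reverse (map (rot 0) rest)) (rot 0 start) (rot⁻ ℓ))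
      , quot-rot-rot⁻ start ℓ

    exit : Occurs (⟦ ℓ + start ⟧ , false) tour
    exit with stair-end (suc ℓ) ℓ ℓ′
    ... | l , eq = ref ℓ , ref⁻ start
      , adj-++ʳ ascent (subst (λ t → Adjacent (ref ℓ) (ref⁻ start) (t ++ descent)) (sym ladder≡)
          (adj-link (stair 1 0 ℓ ++ rot⁻ 0 ∷ ref N ∷ l) (ref ℓ) (ref⁻ start)))
      , quot-ref-ref⁻ ℓ start
      where
      ladder≡ : ladder ≡ (stair 1 0 ℓ ++ rot⁻ 0 ∷ ref N ∷ l) ∷ʳ ref ℓ
      ladder≡ = trans (cong (λ t → stair 1 0 ℓ ++ rot⁻ 0 ∷ ref N ∷ t) eq)
        (sym (++-assoc (stair 1 0 ℓ) (rot⁻ 0 ∷ ref N ∷ l) (ref ℓ ∷ [])))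

    -- For `start` equal to `ℓ` the junctions give -2ℓ and 2ℓ directly. For `suc ℓ` they give -(N +
    -- 1) and N + 1, which are N and -N modulo 2N + 1.
    ±N : Occurs (⟦ N ⟧ , false) tour × Occurs (⊖ ⟦ N ⟧ , false) tour
    ±N with middle
    ... | inj₁ s≡ℓ = subst (λ i → Occurs (i , false) tour) (cong ⟦_⟧ (trans (cong (ℓ +_) s≡ℓ) ℓ+ℓ≡N)) exit
                   , subst (λ i → Occurs (i , false) tour) (cong (λ n → ⊖ ⟦ n ⟧) (trans (cong (_+ ℓ) s≡ℓ) ℓ+ℓ≡N)) entry
    ... | inj₂ s≡1+ℓ =
        subst (λ i → Occurs (i , false) tour) (sym (⟦⟧≡⊖⟦⟧ N (start + ℓ) (trans (cong (λ s → N + (s + ℓ)) s≡1+ℓ)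
          (trans (cong (λ n → N + suc n) ℓ+ℓ≡N) (+-suc N N))))) entry
      , subst (λ i → Occurs (i , false) tour) (⟦⟧≡⊖⟦⟧ (ℓ + start) N (trans (cong (λ s → ℓ + s + N) s≡1+ℓ)
          (trans (cong (_+ N) (+-suc ℓ ℓ)) (cong (λ n → suc n + N) ℓ+ℓ≡N)))) exit

    in-tour : ∀ {g} → Occurs g ascent ⊎ Occurs g descent → Occurs g tour
    in-tour (inj₁ o) = occurs-++ˡ o
    in-tour (inj₂ o) = occurs-++ʳ ascent (occurs-++ʳ ladder o)

    in-ladder′ : ∀ {g} → Occurs g ladder → Occurs g tour
    in-ladder′ o = occurs-++ʳ ascent (occurs-++ˡ o)

    reflections : ∀ c → c ≤ N + N → Occurs (⟦ c ⟧ , true) ladder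
    reflections zero _ with stair-end 1 0 ℓ′
    ... | l , eq = ref 0 , rot⁻ 0 , subst (λ t → Adjacent (ref 0) (rot⁻ 0) (t ++ rot⁻ 0 ∷ ref N ∷ stair (suc ℓ) ℓ ℓ)) (sym eq) (adj-link l (ref 0) (rot⁻ 0))
      , quot-ref-rot⁻ 0 0
    reflections (suc c) c≤ with <-cmp (suc c) N
    ... | tri< c<N _ _ = occurs-++ˡ (stair-quotients 1 0 ℓ (subst (suc c <_) (sym ℓ+ℓ≡N) c<N))
    ... | tri≈ _ c≡N _ = occurs-++ʳ (stair 1 0 ℓ) (rot⁻ 0 , ref N , here , trans (quot-rot⁻-ref 0 N) (cong (λ n → ⟦ n ⟧ , true) (sym c≡N)))
    ... | tri> _ _ N<c with m≤n⇒∃[o]m+o≡n N<c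
    ...   | i , refl with m≤n⇒m<n∨m≡n {suc i} {N} (+-cancelˡ-≤ N (suc i) N (subst (_≤ N + N) (sym (+-suc N i)) c≤))
    ...     | inj₁ i<N = occurs-++ʳ (stair 1 0 ℓ) (occurs-++ʳ (rot⁻ 0 ∷ ref N ∷ [])
      (subst (λ n → Occurs (⟦ n ⟧ , true) (stair (suc ℓ) ℓ ℓ)) (cong (λ n → suc n + i) ℓ+ℓ≡N)
        (stair-quotients (suc ℓ) ℓ ℓ (subst (suc i <_) (sym ℓ+ℓ≡N) i<N))))
    -- The index 2N comes from the link between `ref N` and the first rotation of the second stair,
    -- whose index `suc ℓ + ℓ′` equals `N`.
    ...     | inj₂ i≡N = occurs-++ʳ (stair 1 0 ℓ) (ref N , rot⁻ (suc ℓ + ℓ′) , there here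
      , trans (quot-ref-rot⁻ N (suc ℓ + ℓ′)) (cong (λ n → ⟦ n ⟧ , true)
          (trans (cong (N +_) (trans (sym (+-suc ℓ ℓ′)) (trans ℓ+ℓ≡N (sym i≡N)))) (+-suc N i))))

    tour-quotients : ∀ g → g ≢ D.ε → Occurs g tour
    tour-quotients (i , false) g≢ε with residue i
    ... | plus {zero}  _  = contradiction refl g≢ε
    ... | plus {suc a} a≤ with m≤n⇒m<n∨m≡n a≤
    ...   | inj₁ a<N = in-tour (proj₁ (graceful-quotients graceful 0 (s≤s z≤n) a<N))
    ...   | inj₂ a≡N = subst (λ n → Occurs (⟦ n ⟧ , false) tour) (sym a≡N) (proj₁ ±N)
    tour-quotients (i , false) g≢ε | minus {a} 0<a a≤ with m≤n⇒m<n∨m≡n a≤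
    ...   | inj₁ a<N = in-tour (proj₂ (graceful-quotients graceful 0 0<a a<N))
    ...   | inj₂ a≡N = subst (λ n → Occurs (⊖ ⟦ n ⟧ , false) tour) (sym a≡N) (proj₂ ±N)
    tour-quotients (i , true) _ = in-ladder′ (subst (λ j → Occurs (j , true) ladder) (mod-toℕ i)
      (reflections (toℕ i) (s≤s⁻¹ (subst (toℕ i <_) m≡1+N+N (toℕ<n i)))))

    head-of-tour : List D.Carrier
    head-of-tour = (ascent ++ ladder) ++ map ref⁻ front

    tour≡ : tour ≡ head-of-tour ++ ref⁻ y ∷ ref⁻ z ∷ []
    tour≡ = trans (cong (λ t → ascent ++ ladder ++ t) (trans (cong (map ref⁻) final) (map-++ ref⁻ front (y ∷ z ∷ []))))
      (trans (sym (++-assoc ascent ladder _)) (sym (++-assoc (ascent ++ ladder) (map ref⁻ front) _)))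

    tour-avoids : Avoids (quot (ref⁻ y) (ref⁻ z))
    tour-avoids = record
      { path   = head-of-tour ∷ʳ ref⁻ y
      ; omit   = ref⁻ z
      ; covers = λ g → subst (g ∈_) tour≡′ (tour-covers g)
      ; size   = trans (+-comm 1 _) (trans (sym (length-++ (head-of-tour ∷ʳ ref⁻ y))) (trans (cong length (sym tour≡′)) length-tour))
      ; used   = λ {g} g≢ε g≢x → split g≢x (tour-quotients g g≢ε)
      }
      where
      tour≡′ : tour ≡ (head-of-tour ∷ʳ ref⁻ y) ∷ʳ ref⁻ z
      tour≡′ = trans tour≡ (sym (++-assoc head-of-tour (ref⁻ y ∷ []) (ref⁻ z ∷ [])))
      split : ∀ {g} → g ≢ quot (ref⁻ y) (ref⁻ z) → Occurs g tour → Occurs g (head-of-tour ∷ʳ ref⁻ y)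
      split g≢x (p , q , adj , eq) with adj-init head-of-tour (subst (Adjacent p q) tour≡ adj)
      ... | inj₁ adj′          = p , q , adj′ , eq
      ... | inj₂ (refl , refl) = contradiction (sym eq) g≢x

    -- The sign depends on whether the last step of the labelling goes up or down; `avoids-⊖`
    -- removes the ambiguity later.
    avoids : Avoids (⟦ δ ⟧ , false) ⊎ Avoids (⊖ ⟦ δ ⟧ , false)
    avoids with differences {y} {z} jump
    ... | inj₁ (e , _) = inj₁ (subst (λ i → Avoids (i , false)) (trans (cong (⊖ ⟦ y ⟧ ⊕_) (Aₚ.⁻¹-involutive ⟦ z ⟧)) e) tour-avoids)
    ... | inj₂ (e , _) = inj₂ (subst (λ i → Avoids (i , false)) (trans (cong (⊖ ⟦ y ⟧ ⊕_) (Aₚ.⁻¹-involutive ⟦ z ⟧)) e) tour-avoids)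

  module FromZigzag where

    -- Written so that `N` reduces to `suc N′`, which makes `0 ∷ rest` a zigzag of length `N` by
    -- computation.
    N′ : ℕ
    N′ = ℓ′ + 1 * ℓ

    rest : List ℕ
    rest = zig high N′ 1 0

    graceful : Graceful 0 N (0 ∷ rest)
    graceful = record
      { size   = length-zig low N 0 0
      -- The zigzag takes all `N` labels, so the interval left over is empty.
      ; covers = λ {x} _ x< → [ (λ x∈ → x∈) , (λ (o≤ , <o) → contradiction (<-≤-trans <o (≤-trans (≤-reflexive (+-identityʳ _)) o≤)) (<-irrefl refl)) ]′
          (zig-covers low N 0 0 z≤n (subst (x <_) (sym (+-identityʳ N)) x<))
      ; jumps  = λ {d} 0<d d<N → zig-jumps high N′ refl 0<d (subst (d ≤_) (sym (+-identityʳ N′)) (s≤s⁻¹ d<N))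
      }

    -- A single stair gives all reflections 0, ..., 2N. Its last vertex also serves as the vertex of
    -- label 0 in the descent, so only one junction remains, from rotation 1 to rotation -N; it
    -- contributes -(N + 1), which is N.
    ascent ladder tour : List D.Carrier
    ascent = reverse (map (rot 1) (0 ∷ rest))
    ladder = stair 0 0 (suc N)
    tour   = ascent ++ ladder ++ map ref⁻ rest

    in-tour : ∀ {g} → Occurs g ascent ⊎ Occurs g (map ref⁻ (0 ∷ rest)) → Occurs g tour
    in-tour (inj₁ o) = occurs-++ˡ o
    in-tour {g} (inj₂ o) with stair-end 0 0 N
    ... | l , eq = occurs-++ʳ ascent (subst (Occurs g) l≡ (occurs-++ʳ l o))
      where
      l≡ : l ++ map ref⁻ (0 ∷ rest) ≡ ladder ++ map ref⁻ rest
      -- `ref⁻ 0` coincides with `ref 0`, the last vertex of the ladder.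
      l≡ = trans (cong (λ i → l ++ (i , true) ∷ map ref⁻ rest) Aₚ.ε⁻¹≈ε)
        (trans (sym (++-assoc l (ref 0 ∷ []) (map ref⁻ rest))) (cong (_++ map ref⁻ rest) (sym eq)))

    entry : Occurs (⟦ N ⟧ , false) tour
    entry = rot 1 0 , rot⁻ N
      , subst (λ r → Adjacent (rot 1 0) (rot⁻ N) (r ++ ladder ++ map ref⁻ rest))
          (sym (unfold-reverse (rot 1 0) (map (rot 1) rest)))
          (adj-link (reverse (map (rot 1) rest)) (rot 1 0) (rot⁻ N))
      , trans (quot-rot-rot⁻ 1 N) (cong (_, false) (sym (⟦⟧≡⊖⟦⟧ N (suc N) (+-suc N N))))

    tour-covers : ∀ g → g ∈ tour ∷ʳ ref⁻ N
    tour-covers (i , false) with residue i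
    ... | plus {zero}  _  = ∈-++⁺ˡ (∈-++⁺ʳ ascent (∈-++⁺ˡ
      (subst (λ j → (j , false) ∈ ladder) Aₚ.ε⁻¹≈ε (rot⁻∈stair 0 0 (suc N) (s≤s z≤n)))))
    ... | plus {suc a} a≤ = ∈-++⁺ˡ (∈-++⁺ˡ (rotations 1 graceful z≤n a≤))
    ... | minus {a} _ a≤  = ∈-++⁺ˡ (∈-++⁺ʳ ascent (∈-++⁺ˡ (rot⁻∈stair 0 0 (suc N) (s≤s a≤))))
    tour-covers (i , true) with residue i
    ... | plus {a} a≤     = ∈-++⁺ˡ (∈-++⁺ʳ ascent (∈-++⁺ˡ (ref∈stair 0 0 (suc N) (s≤s a≤))))
    ... | minus {a} 0<a a≤ with m≤n⇒m<n∨m≡n a≤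
    ...   | inj₂ refl = ∈-++⁺ʳ tour (here refl)
    ...   | inj₁ a<N with Graceful.covers graceful z≤n a<N
    ...     | here refl = contradiction 0<a (<-irrefl refl)
    ...     | there a∈  = ∈-++⁺ˡ (∈-++⁺ʳ ascent (∈-++⁺ʳ ladder (∈-map⁺ ref⁻ a∈)))

    tour-quotients : ∀ g → g ≢ D.ε → g ≢ (⊖ ⟦ N ⟧ , false) → Occurs g tour
    tour-quotients (i , false) g≢ε g≢x with residue i
    ... | plus {zero}  _  = contradiction refl g≢ε
    ... | plus {suc a} a≤ with m≤n⇒m<n∨m≡n a≤
    ...   | inj₁ a<N = in-tour (proj₁ (graceful-quotients graceful 1 (s≤s z≤n) a<N))
    ...   | inj₂ a≡N = subst (λ n → Occurs (⟦ n ⟧ , false) tour) (sym a≡N) entry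
    tour-quotients (i , false) g≢ε g≢x | minus {a} 0<a a≤ with m≤n⇒m<n∨m≡n a≤
    ...   | inj₁ a<N  = in-tour (proj₂ (graceful-quotients graceful 1 0<a a<N))
    ...   | inj₂ refl = contradiction refl g≢x
    tour-quotients (i , true) _ _ = occurs-++ʳ ascent (occurs-++ˡ (subst (λ j → Occurs (j , true) ladder) (mod-toℕ i)
      (stair-quotients 0 0 (suc N) (s<s (subst (toℕ i <_) (trans m≡1+N+N (sym (+-suc N N))) (toℕ<n i))))))

    length-tour : suc (length tour) ≡ m + m
    length-tour = begin
      suc (length tour)                                              ≡⟨ cong suc (length-++ ascent) ⟩
      suc (length ascent + length (ladder ++ map ref⁻ rest))         ≡⟨ cong suc (cong₂ _+_ l₁ (trans (length-++ ladder) (cong₂ _+_ (length-stair 0 0 (suc N)) l₂))) ⟩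
      suc (N + (suc N + suc N + N′))                                 ≡⟨ lemma ℓ′ ⟩
      m + m                                                          ∎
      where
      open ≡-Reasoning
      l₁ : length ascent ≡ N
      l₁ = trans (length-reverse (map (rot 1) (0 ∷ rest))) (trans (length-map (rot 1) (0 ∷ rest)) (Graceful.size graceful))
      l₂ : length (map ref⁻ rest) ≡ N′
      l₂ = trans (length-map ref⁻ rest) (length-zig high N′ 1 0)
      lemma : ∀ l → suc (2 * suc l + (suc (2 * suc l) + suc (2 * suc l) + (l + 1 * suc l))) ≡ 1 + 4 * suc l + (1 + 4 * suc l)
      lemma = solve-∀

    avoids : Avoids (⊖ ⟦ N ⟧ , false)
    avoids = record
      { path   = tour
      ; omit   = ref⁻ N
      ; covers = tour-covers
      ; size   = length-tour
      ; used   = λ {g} → tour-quotients g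
      }

-- Elements of the same order

-- Dividing `n` by its gcd with `a` until that gcd is 1 leaves `c`; each of the `k` divisions
-- removes a divisor of `a`.
coprimePart : ∀ a n → 0 < n → ∃₂ λ c k → Coprime a c × n ∣ a ^ k * c
coprimePart a = <-rec (λ n → 0 < n → ∃₂ λ c k → Coprime a c × n ∣ a ^ k * c) step
  where
  step : ∀ n → (∀ {n′} → n′ < n → 0 < n′ → ∃₂ λ c k → Coprime a c × n′ ∣ a ^ k * c) →
         0 < n → ∃₂ λ c k → Coprime a c × n ∣ a ^ k * c
  step n rec 0<n with gcd a n in eq | gcd[m,n]∣m a n | gcd[m,n]∣n a n
  ... | 0            | _   | 0∣n = contradiction (sym (0∣⇒≡0 0∣n)) (<⇒≢ 0<n)
  ... | 1            | _   | _ = n , 0 , gcd≡1⇒coprime eq , ∣-reflexive (sym (+-identityʳ n))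
  ... | suc (suc h)  | h∣a | divides zero    refl = contradiction 0<n (<-irrefl refl)
  ... | suc (suc h)  | h∣a | divides (suc n′) refl
    with rec {suc n′} (subst (_< suc n′ * suc (suc h)) (*-identityʳ (suc n′)) (*-monoʳ-< (suc n′) (s<s z<s))) z<s
  ...   | c , k , a⊥c , n′∣ = c , suc k , a⊥c , subst (suc n′ * suc (suc h) ∣_) (lemma a (a ^ k) c) (*-pres-∣ n′∣ h∣a)
    where
    lemma : ∀ a b c → b * c * a ≡ a * b * c
    lemma = solve-∀

coprime-^-divisor : ∀ {d a} k {c} → Coprime d a → d ∣ a ^ k * c → d ∣ c
coprime-^-divisor {d} zero {c} ⊥a d∣ = subst (d ∣_) (+-identityʳ c) d∣
coprime-^-divisor {d} {a} (suc k) {c} ⊥a d∣ =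
  coprime-^-divisor k ⊥a (coprime-divisor ⊥a (subst (d ∣_) (*-assoc a (a ^ k) c) d∣))

-- A common divisor of a + bc and n is prime to a, so it divides c and hence a.
coprime-lift : ∀ {a b} n → 0 < n → Coprime a b → ∃ λ c → Coprime (a + b * c) n
coprime-lift {a} {b} n 0<n a⊥b with coprimePart a n 0<n
... | c , k , a⊥c , n∣ = c , λ {d} (d∣t , d∣n) →
  let d⊥a : Coprime d a
      d⊥a = λ {e} (e∣d , e∣a) →
        let e⊥b : Coprime e b
            e⊥b = λ (f∣e , f∣b) → a⊥b (∣-trans f∣e e∣a , f∣b)
        in a⊥c (e∣a , coprime-divisor e⊥b (∣m+n∣m⇒∣n (∣-trans e∣d d∣t) e∣a))
      d∣c = coprime-^-divisor k d⊥a (∣-trans d∣n n∣)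
  in d⊥a (∣-refl , ∣m+n∣m⇒∣n (subst (d ∣_) (+-comm a (b * c)) d∣t) (∣n⇒∣m*n b d∣c))

-- Arithmetic modulo m, dihedral automorphisms and orders of rotations.

module Modular (m : ℕ) .{{_ : NonZero m}} where

  open Cyclic m
  open DihedralPaths m
  private module Aₚ = AbelianGroupProperties abelianGroup

  ⟦⟧-cong : ∀ {a b} → a % m ≡ b % m → ⟦ a ⟧ ≡ ⟦ b ⟧
  ⟦⟧-cong {a} {b} eq = toℕ-injective (trans (toℕ-mod a) (trans eq (sym (toℕ-mod b))))

  ⟦⟧-+* : ∀ a k → ⟦ a + k * m ⟧ ≡ ⟦ a ⟧
  ⟦⟧-+* a k = ⟦⟧-cong ([m+kn]%n≡m%n a k m)

  ⟦⟧-≡ : ∀ a b → ⟦ a ⟧ ≡ ⟦ b ⟧ → ∃₂ λ k l → a + k * m ≡ b + l * m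
  ⟦⟧-≡ a b eq = b / m , a / m , (begin
    a + b / m * m                  ≡⟨ cong (_+ b / m * m) (m≡m%n+[m/n]*n a m) ⟩
    a % m + a / m * m + b / m * m  ≡⟨ cong (λ r → r + a / m * m + b / m * m) (trans (sym (toℕ-mod a)) (trans (cong toℕ eq) (toℕ-mod b))) ⟩
    b % m + a / m * m + b / m * m  ≡⟨ lemma (b % m) (a / m * m) (b / m * m) ⟩
    b % m + b / m * m + a / m * m  ≡⟨ cong (_+ a / m * m) (m≡m%n+[m/n]*n b m) ⟨
    b + a / m * m                  ∎)
    where
    open ≡-Reasoning
    lemma : ∀ x y z → x + y + z ≡ x + z + y
    lemma = solve-∀

  ⟦⟧-*ˡ : ∀ t a b → ⟦ a ⟧ ≡ ⟦ b ⟧ → ⟦ t * a ⟧ ≡ ⟦ t * b ⟧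
  ⟦⟧-*ˡ t a b eq with ⟦⟧-≡ a b eq
  ... | k , l , eq′ = trans (sym (⟦⟧-+* (t * a) (t * k)))
    (trans (cong ⟦_⟧ (trans (lemma t a k m) (trans (cong (t *_) eq′) (sym (lemma t b l m))))) (⟦⟧-+* (t * b) (t * l)))
    where
    lemma : ∀ t a k m → t * a + t * k * m ≡ t * (a + k * m)
    lemma = solve-∀

  bezout : ∀ a → ∃ λ s → ⟦ s * a ⟧ ≡ ⟦ gcd a m ⟧
  bezout a with Bézout.identity (gcd-GCD a m)
  ... | Bézout.+- x y eq = x , trans (cong ⟦_⟧ (sym eq)) (⟦⟧-+* (gcd a m) y)
  -- Here the coefficient of `a` would be -x; `pred m` stands for -1 modulo `m`.
  ... | Bézout.-+ x y eq = pred m * x , (begin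
    ⟦ pred m * x * a ⟧                          ≡⟨ ⟦⟧-+* (pred m * x * a) y ⟨
    ⟦ pred m * x * a + y * m ⟧                  ≡⟨ cong (λ n → ⟦ pred m * x * a + n ⟧) eq ⟨
    ⟦ pred m * x * a + (gcd a m + x * a) ⟧      ≡⟨ cong ⟦_⟧ (lemma (pred m) (gcd a m) x a) ⟩
    ⟦ gcd a m + x * a * suc (pred m) ⟧          ≡⟨ cong (λ n → ⟦ gcd a m + x * a * n ⟧) (suc-pred m) ⟩
    ⟦ gcd a m + x * a * m ⟧                     ≡⟨ ⟦⟧-+* (gcd a m) (x * a) ⟩
    ⟦ gcd a m ⟧                                 ∎)
    where
    open ≡-Reasoning
    lemma : ∀ k g x a → k * x * a + (g + x * a) ≡ g + x * a * suc k
    lemma = solve-∀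

  -- Applying `f` to the index and keeping the flag extends `f` to an endomorphism of the dihedral
  -- group. It commutes with `quot` and is onto, so it carries the path and its quotients along.
  avoids-map : ∀ (f : Fin m → Fin m) → (∀ i j → f (i ⊕ j) ≡ f i ⊕ f j) → (∀ i → ∃ λ j → f j ≡ i) →
               ∀ {i} → Avoids (i , false) → Avoids (f i , false)
  avoids-map f f-⊕ f-onto {i} av = record
    { path   = map φ path
    ; omit   = φ omit
    ; covers = λ g → let h , eq = φ-onto g in
        subst₂ _∈_ eq (map-++ φ path (omit ∷ [])) (∈-map⁺ φ (covers h))
    ; size   = trans (cong suc (length-map φ path)) size
    ; used   = λ {g} g≢ε g≢x →
        let h , eq = φ-onto g
            p , q , adj , eq′ = used {h} (λ h≡ε → g≢ε (trans (sym eq) (trans (cong φ h≡ε) (cong (_, false) f-0))))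
                                         (λ h≡x → g≢x (trans (sym eq) (cong φ h≡x)))
        in φ p , φ q , adj-map φ adj , trans (φ-quot p q) (trans (cong φ eq′) eq)
    }
    where
    open Avoids av
    φ : D.Carrier → D.Carrier
    φ (i , s) = f i , s
    φ-onto : ∀ g → ∃ λ h → φ h ≡ g
    φ-onto (i , s) with f-onto i
    ... | j , eq = (j , s) , cong (_, s) eq
    f-0 : f 0# ≡ 0#
    f-0 = Aₚ.identityˡ-unique (f 0#) (f 0#) (trans (sym (f-⊕ 0# 0#)) (cong f (⊕-identityˡ 0#)))
    f-⊖ : ∀ i → f (⊖ i) ≡ ⊖ f i
    f-⊖ i = Aₚ.inverseˡ-unique (f (⊖ i)) (f i) (trans (sym (f-⊕ (⊖ i) i)) (trans (cong f (⊕-inverseˡ i)) f-0))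
    φ-quot : ∀ p q → quot (φ p) (φ q) ≡ φ (quot p q)
    φ-quot (i , false) (j , t) = cong (_, t) (trans (cong (_⊕ f j) (sym (f-⊖ i))) (sym (f-⊕ (⊖ i) j)))
    φ-quot (i , true)  (j , t) = cong (_, not t) (trans (cong (f i ⊕_) (sym (f-⊖ j))) (sym (f-⊕ i (⊖ j))))

  avoids-⊖ : ∀ {i} → Avoids (⊖ i , false) → Avoids (i , false)
  avoids-⊖ {i} av = subst (λ j → Avoids (j , false)) (Aₚ.⁻¹-involutive i)
    (avoids-map ⊖_ (λ i j → sym (Aₚ.⁻¹-∙-comm i j)) (λ i → ⊖ i , Aₚ.⁻¹-involutive i) av)

  avoids-* : ∀ t a → Coprime t m → Avoids (⟦ a ⟧ , false) → Avoids (⟦ t * a ⟧ , false)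
  avoids-* t a t⊥m av = subst (λ i → Avoids (i , false)) (f-⟦⟧ a) (avoids-map f f-⊕ f-onto av)
    where
    f : Fin m → Fin m
    f i = ⟦ t * toℕ i ⟧
    f-⟦⟧ : ∀ a → f ⟦ a ⟧ ≡ ⟦ t * a ⟧
    f-⟦⟧ a = ⟦⟧-*ˡ t (toℕ ⟦ a ⟧) a (mod-toℕ ⟦ a ⟧)
    f-⊕ : ∀ i j → f (i ⊕ j) ≡ f i ⊕ f j
    f-⊕ i j = trans (f-⟦⟧ (toℕ i + toℕ j)) (trans (cong ⟦_⟧ (*-distribˡ-+ t (toℕ i) (toℕ j))) (sym (mod-⊕-mod (t * toℕ i) (t * toℕ j))))
    f-onto : ∀ i → ∃ λ j → f j ≡ i
    -- As `t` is coprime to `m`, the Bézout coefficient `s` is an inverse of `t` modulo `m`.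
    f-onto i with bezout t
    ... | s , eq = ⟦ s * toℕ i ⟧ , (begin
      f ⟦ s * toℕ i ⟧             ≡⟨ f-⟦⟧ (s * toℕ i) ⟩
      ⟦ t * (s * toℕ i) ⟧         ≡⟨ cong ⟦_⟧ (lemma t s (toℕ i)) ⟩
      ⟦ toℕ i * (s * t) ⟧         ≡⟨ ⟦⟧-*ˡ (toℕ i) (s * t) 1 (trans eq (cong ⟦_⟧ (coprime⇒gcd≡1 t⊥m))) ⟩
      ⟦ toℕ i * 1 ⟧               ≡⟨ cong ⟦_⟧ (*-identityʳ (toℕ i)) ⟩
      ⟦ toℕ i ⟧                   ≡⟨ mod-toℕ i ⟩
      i                           ∎)
      where
      open ≡-Reasoning
      lemma : ∀ t s i → t * (s * i) ≡ i * (s * t)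
      lemma = solve-∀

  gcd-nonZero : ∀ a → NonZero (gcd a m)
  gcd-nonZero a = ≢-nonZero λ g≡0 → ≢-nonZero⁻¹ m (trans (equality (gcd[m,n]∣n a m))
    (trans (cong (quotient (gcd[m,n]∣n a m) *_) g≡0) (*-zeroʳ (quotient (gcd[m,n]∣n a m)))))
    where open _∣_

  Cofactors : ℕ → Set
  Cofactors a = ∃₂ λ a′ m′ → a ≡ a′ * gcd a m × m ≡ m′ * gcd a m × Coprime a′ m′

  cofactors : ∀ a → Cofactors a
  cofactors a = go (gcd[m,n]∣m a m) (gcd[m,n]∣n a m)
    where
    go : gcd a m ∣ a → gcd a m ∣ m → Cofactors a
    go (divides a′ a≡) (divides m′ m≡) = a′ , m′ , a≡ , m≡ , λ {d} (d∣a′ , d∣m′) →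
      ∣1⇒≡1 (*-cancelʳ-∣ (gcd a m) {{gcd-nonZero a}}
        (subst (d * gcd a m ∣_) (sym (*-identityˡ (gcd a m)))
          (gcd-greatest (subst (d * gcd a m ∣_) (sym a≡) (*-monoˡ-∣ (gcd a m) d∣a′))
                        (subst (d * gcd a m ∣_) (sym m≡) (*-monoˡ-∣ (gcd a m) d∣m′)))))

  -- The factor `b′ * s` takes `a` to `b` but is only known to be coprime to `m′`. Adding multiples
  -- of `m′` does not change the product with `a`, because `m′ * a` is `a′ * m`, and `coprime-lift`
  -- finds one that makes the factor coprime to `m`.
  unit-multiple : ∀ {a a′ b b′ m′ g} .{{_ : NonZero g}} → a ≡ a′ * g → b ≡ b′ * g → m ≡ m′ * g →
                  Coprime b′ m′ → (∃ λ s → ⟦ s * a ⟧ ≡ ⟦ g ⟧) → ∃ λ t → Coprime t m × ⟦ t * a ⟧ ≡ ⟦ b ⟧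
  unit-multiple {a} {a′} {b} {b′} {m′} {g} a≡ b≡ m≡ b′⊥m′ (s , sa≡g) =
    let c , t⊥m = coprime-lift m (>-nonZero⁻¹ m) b′s⊥m′ in
    b′ * s + m′ * c , t⊥m , (begin
    ⟦ (b′ * s + m′ * c) * a ⟧                    ≡⟨ cong (λ n → ⟦ (b′ * s + m′ * c) * n ⟧) a≡ ⟩
    ⟦ (b′ * s + m′ * c) * (a′ * g) ⟧             ≡⟨ cong ⟦_⟧ (expand (b′ * s) m′ c a′ g) ⟩
    ⟦ b′ * s * (a′ * g) + c * a′ * (m′ * g) ⟧    ≡⟨ cong₂ (λ x y → ⟦ b′ * s * x + c * a′ * y ⟧) a≡ m≡ ⟨
    ⟦ b′ * s * a + c * a′ * m ⟧                  ≡⟨ ⟦⟧-+* (b′ * s * a) (c * a′) ⟩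
    ⟦ b′ * s * a ⟧                               ≡⟨ b′sa≡b ⟩
    ⟦ b ⟧                                        ∎)
    where
    open ≡-Reasoning
    expand : ∀ x m′ c a′ g → (x + m′ * c) * (a′ * g) ≡ x * (a′ * g) + c * a′ * (m′ * g)
    expand = solve-∀
    factor : ∀ x y z m′ g → (x * y + z * m′) * g ≡ x * (y * g) + z * (m′ * g)
    factor = solve-∀
    factor′ : ∀ y z m′ g → (y + z * m′) * g ≡ y * g + z * (m′ * g)
    factor′ = solve-∀
    b′sa≡b : ⟦ b′ * s * a ⟧ ≡ ⟦ b ⟧
    b′sa≡b = trans (cong ⟦_⟧ (*-assoc b′ s a)) (trans (⟦⟧-*ˡ b′ (s * a) g sa≡g) (cong ⟦_⟧ (sym b≡)))
    b′s⊥m′ : Coprime (b′ * s) m′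
    -- Cancelling `g` turns the congruence into `b′ * s * a′` ≡ `b′` modulo `m′`, so a common
    -- divisor of `b′ * s` and `m′` divides `b′` as well.
    b′s⊥m′ {d} (d∣b′s , d∣m′) =
      let k , l , eq = ⟦⟧-≡ (b′ * s * a) b b′sa≡b
          eq′ : b′ * s * a′ + k * m′ ≡ b′ + l * m′
          eq′ = *-cancelʳ-≡ (b′ * s * a′ + k * m′) (b′ + l * m′) g (begin
            (b′ * s * a′ + k * m′) * g            ≡⟨ factor (b′ * s) a′ k m′ g ⟩
            b′ * s * (a′ * g) + k * (m′ * g)      ≡⟨ cong₂ (λ x y → b′ * s * x + k * y) a≡ m≡ ⟨
            b′ * s * a + k * m                    ≡⟨ eq ⟩
            b + l * m                             ≡⟨ cong₂ (λ x y → x + l * y) b≡ m≡ ⟩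
            b′ * g + l * (m′ * g)                 ≡⟨ factor′ b′ l m′ g ⟨
            (b′ + l * m′) * g                     ∎)
      in b′⊥m′ (∣m+n∣m⇒∣n (subst (d ∣_) (trans eq′ (+-comm b′ (l * m′)))
                  (∣m∣n⇒∣m+n (∣m⇒∣m*n a′ d∣b′s) (∣n⇒∣m*n k d∣m′))) (∣n⇒∣m*n l d∣m′) , d∣m′)

  associates : ∀ a b → gcd a m ≡ gcd b m → ∃ λ t → Coprime t m × ⟦ t * a ⟧ ≡ ⟦ b ⟧
  associates a b g≡ = go (cofactors a) (cofactors b)
    where
    go : Cofactors a → Cofactors b → ∃ λ t → Coprime t m × ⟦ t * a ⟧ ≡ ⟦ b ⟧
    go (a′ , _ , a≡ , _) (b′ , m′ , b≡ , m≡ , b′⊥m′) = unit-multiple {a′ = a′} {{gcd-nonZero b}}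
      (trans a≡ (cong (a′ *_) g≡)) b≡ m≡ b′⊥m′ (proj₁ (bezout a) , trans (proj₂ (bezout a)) (cong ⟦_⟧ g≡))

  avoids-gcd : ∀ a b → gcd a m ≡ gcd b m → Avoids (⟦ a ⟧ , false) → Avoids (⟦ b ⟧ , false)
  avoids-gcd a b g≡ av = let t , t⊥m , eq = associates a b g≡ in
    subst (λ i → Avoids (i , false)) eq (avoids-* t a t⊥m av)

  rotation-pow : ∀ a n → pow (Dihedral m) (⟦ a ⟧ , false) n ≡ (⟦ n * a ⟧ , false)
  rotation-pow a zero    = refl
  rotation-pow a (suc n) = trans (cong ((⟦ a ⟧ , false) D.∙_) (rotation-pow a n)) (cong (_, false) (mod-⊕-mod a (n * a)))

  -- `m′` annihilates the rotation since `m′ * a` is `a′ * m`. Conversely `m` divides `n * a`;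
  -- cancelling `g` and then the coprime `a′` shows that `m′` divides `n`.
  order-cofactor : ∀ {a a′ m′ g n} .{{_ : NonZero g}} → a ≡ a′ * g → m ≡ m′ * g → Coprime a′ m′ →
                   HasOrder (Dihedral m) (⟦ a ⟧ , false) n → n ≡ m′
  order-cofactor {a} {a′} {m′} {g} {n} a≡ m≡ a′⊥m′ (0<n , pow≡ε , least) = ≤-antisym n≤m′ m′≤n
    where
    0<m′ : 0 < m′
    0<m′ = n≢0⇒n>0 λ { refl → ≢-nonZero⁻¹ m m≡ }
    lemma : ∀ x y z → x * (y * z) ≡ y * (x * z)
    lemma = solve-∀
    n≤m′ : n ≤ m′
    n≤m′ = least m′ 0<m′ (trans (rotation-pow a m′) (cong (_, false)
      (trans (cong ⟦_⟧ (trans (cong (m′ *_) a≡) (trans (lemma m′ a′ g) (cong (a′ *_) (sym m≡))))) (⟦⟧-+* 0 a′))))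
    m∣na : m ∣ n * a
    m∣na = m%n≡0⇒n∣m (n * a) m (trans (sym (toℕ-mod (n * a))) (trans (cong (λ x → toℕ (proj₁ x)) (trans (sym (rotation-pow a n)) pow≡ε)) toℕ-0#))
    m′≤n : m′ ≤ n
    m′≤n = ∣⇒≤ {{>-nonZero 0<n}} (coprime-divisor (Coprimality.sym a′⊥m′)
      (subst (m′ ∣_) (*-comm n a′) (*-cancelʳ-∣ g
        (subst₂ _∣_ m≡ (trans (cong (n *_) a≡) (sym (*-assoc n a′ g))) m∣na))))

  rotation-order : ∀ a {n} → HasOrder (Dihedral m) (⟦ a ⟧ , false) n → n * gcd a m ≡ m
  rotation-order a {n} o = go (cofactors a)
    where
    go : Cofactors a → n * gcd a m ≡ m
    go (a′ , m′ , a≡ , m≡ , a′⊥m′) = trans (cong (_* gcd a m) (order-cofactor {{gcd-nonZero a}} a≡ m≡ a′⊥m′ o)) (sym m≡)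

module SameOrders (ℓ : ℕ) where

  m : ℕ
  m = 1 + 4 * ℓ

  open DihedralPaths m
  open Modular m
  open Cyclic m

  -- A reflection has order 2, while `rotation-order` makes the common order a divisor of the odd
  -- number `m`; so `x` is a rotation. Equal orders then mean equal gcds with `m`.
  same-order⇒rotation : ∀ {x a} → x ≢ D.ε → SameOrder (Dihedral m) x (⟦ a ⟧ , false) →
                        ∃ λ b → gcd a m ≡ gcd b m × x ≡ (⟦ b ⟧ , false)
  same-order⇒rotation {i , false} {a} _ (n , ox@(0<n , _) , oy) = toℕ i
    , *-cancelˡ-≡ (gcd a m) (gcd (toℕ i) m) n {{>-nonZero 0<n}}
        (trans (rotation-order a oy) (sym (rotation-order (toℕ i)
          (subst (λ j → HasOrder (Dihedral m) (j , false) n) (sym (mod-toℕ i)) ox))))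
    , cong (_, false) (sym (mod-toℕ i))
  same-order⇒rotation {i , true} {a} x≢ε (n , (0<n , pow≡ε , least) , oy) = ⊥-elim (cases n 0<n pow≡ε
    (least 2 z<s (trans (cong ((i , true) D.∙_) (D.identityʳ (i , true))) (D.inverseʳ (i , true)))) (rotation-order a oy))
    where
    cases : ∀ n → 0 < n → pow (Dihedral m) (i , true) n ≡ D.ε → n ≤ 2 → n * gcd a m ≡ m → ⊥
    cases 1 _ p _ _ = x≢ε (trans (sym (D.identityʳ (i , true))) p)
    cases 2 _ _ _ e = even≢odd (gcd a m) (2 * ℓ) (trans e (cong suc (lemma ℓ)))
      where
      lemma : ∀ l → 4 * l ≡ 2 * (2 * l)
      lemma = solve-∀
    cases (suc (suc (suc _))) _ _ (s≤s (s≤s ())) _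

  avoidable⇒sequencing : ∀ {x} a b → Avoids (⟦ a ⟧ , false) → x ≢ D.ε →
    gcd a m ≡ gcd b m → SameOrder (Dihedral m) x (pow (Dihedral m) (u m) b) →
    ∀ S → Unique S → D.ε ∉ S → x ∉ S → length S ≡ 8 * ℓ → HasSequencing (Dihedral m) S
  avoidable⇒sequencing {x} a b av x≢ε g≡ same S uS ε∉ x∉ len =
    let c , g≡′ , x≡ = same-order⇒rotation {a = b} x≢ε (subst (SameOrder (Dihedral m) x) (u^n m b) same)
    in avoids⇒sequencing (subst Avoids (sym x≡) (avoids-gcd a c (trans g≡ g≡′) av)) S uS ε∉ x∉
         (trans (cong (2 +_) len) (lemma ℓ))
    where
    lemma : ∀ l → 2 + 8 * l ≡ 1 + 4 * l + (1 + 4 * l)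
    lemma = solve-∀

-- Combining the cases.

avoids-2ℓ : ∀ ℓ → 0 < ℓ → DihedralPaths.Avoids (1 + 4 * ℓ) ((2 * ℓ) mod (1 + 4 * ℓ) , false)
avoids-2ℓ (suc ℓ′) _ = Modular.avoids-⊖ (1 + 4 * suc ℓ′) (Constructions.FromZigzag.avoids ℓ′)

avoids-spiral : ∀ ℓ {δ} → 0 < ℓ → Spiral ℓ δ → DihedralPaths.Avoids (1 + 4 * ℓ) (δ mod (1 + 4 * ℓ) , false)
avoids-spiral (suc ℓ′) _ s with Constructions.FromSpiral.avoids ℓ′ s
... | inj₁ av = av
... | inj₂ av = Modular.avoids-⊖ (1 + 4 * suc ℓ′) av

-- Only the gcd with the modulus is prescribed, that is, the order of the rotation. This freedom
-- lets the exceptional cases fall back on 2ℓ or 2ℓ - 1.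
avoidable : ∀ ℓ p q r → 0 < ℓ → 0 < p → 0 < q → 2 * ℓ ≡ p * q + r → p ≤ 2 * r → r ≤ 20 →
            ∃ λ a → gcd a (1 + 4 * ℓ) ≡ gcd (2 * ℓ ∸ p + 1) (1 + 4 * ℓ) ×
                    DihedralPaths.Avoids (1 + 4 * ℓ) (a mod (1 + 4 * ℓ) , false)
avoidable ℓ 1 q r 0<ℓ _ 0<q 2ℓ≡ p≤ r≤ = 2 * ℓ
  , cong (λ a → gcd a (1 + 4 * ℓ)) (sym (m∸n+n≡m (≤-trans 0<ℓ (m≤m+n ℓ _)))) , avoids-2ℓ ℓ 0<ℓ
avoidable ℓ (suc (suc p)) q r 0<ℓ _ 0<q 2ℓ≡ p≤ r≤ = cases q 0<q 2ℓ≡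
  (available (s≤s (≤-trans p≤ (*-monoʳ-≤ 2 r≤))) (s<s z<s) (s≤s r≤)
    (≤-trans (⌈n/2⌉-mono p≤) (≤-reflexive (trans (cong (λ s → ⌈ r + s /2⌉) (+-identityʳ r)) (sym (n≡⌈n+n/2⌉ r))))))
  where
  P = suc (suc p)
  Goal = ∃ λ a → gcd a (1 + 4 * ℓ) ≡ gcd (2 * ℓ ∸ P + 1) (1 + 4 * ℓ) ×
                    DihedralPaths.Avoids (1 + 4 * ℓ) (a mod (1 + 4 * ℓ) , false)
  P<41 : P < 41
  P<41 = s≤s (≤-trans p≤ (*-monoʳ-≤ 2 r≤))
  from-spiral : Spiral ℓ (suc (2 * ℓ ∸ P)) → Goal
  from-spiral s = suc (2 * ℓ ∸ P) , cong (λ a → gcd a (1 + 4 * ℓ)) (+-comm 1 (2 * ℓ ∸ P)) , avoids-spiral ℓ 0<ℓ s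
  modulus : ∀ {n} → 2 * ℓ ≡ n → suc (2 * n) ≡ 1 + 4 * ℓ
  modulus refl = cong suc (lemma ℓ)
    where
    lemma : ∀ l → 2 * (2 * l) ≡ 4 * l
    lemma = solve-∀
  short : 2 * ℓ ≡ P + r → Exceptional P r → Goal
  -- The sum `P + r` is `2 * ℓ`, hence even.
  short 2ℓ≡ (inj₁ odd) = contradiction (trans (sym odd) (trans (cong (_% 2) (trans (sym 2ℓ≡) (*-comm 2 ℓ))) (m*n%n≡0 ℓ 2))) λ ()
  short 2ℓ≡ (inj₂ (inj₁ e)) = 2 * ℓ , trans (cong₂ gcd 2ℓ≡ (sym (modulus 2ℓ≡)))
    (trans (sym e) (cong₂ gcd δ≡ (modulus 2ℓ≡))) , avoids-2ℓ ℓ 0<ℓ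
    where
    δ≡ : suc r ≡ 2 * ℓ ∸ P + 1
    δ≡ = trans (+-comm 1 r) (cong (_+ 1) (sym (trans (cong (_∸ P) 2ℓ≡) (m+n∸m≡n P r))))
  -- The value 2ℓ - 1 belongs to zigzags of length 2. They apply with ℓ - 1 rounds around a seed of
  -- length 2, as `P + r` ≥ 3 excludes ℓ = 1.
  short 2ℓ≡ (inj₂ (inj₂ e)) = suc (2 * ℓ ∸ 2) , trans (cong₂ gcd (cong (λ n → suc (n ∸ 2)) 2ℓ≡) (sym (modulus 2ℓ≡)))
    (trans (sym e) (cong₂ gcd δ≡ (modulus 2ℓ≡))) , avoids-spiral ℓ 0<ℓ (zigzag ℓ 2ℓ≡)
    where
    δ≡ : suc r ≡ 2 * ℓ ∸ P + 1
    δ≡ = trans (+-comm 1 r) (cong (_+ 1) (sym (trans (cong (_∸ P) 2ℓ≡) (m+n∸m≡n P r))))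
    0<r : 0 < r
    0<r = n≢0⇒n>0 λ { refl → contradiction p≤ λ () }
    zigzag : ∀ ℓ → 2 * ℓ ≡ P + r → Spiral ℓ (suc (2 * ℓ ∸ 2))
    zigzag 1             eq = contradiction (subst (3 ≤_) (sym eq) (+-mono-≤ (s≤s (s≤s (z≤n {p}))) 0<r)) λ { (s≤s (s≤s ())) }
    zigzag (suc (suc ℓ)) eq = spiral 0 (suc ℓ) 2 (suc (suc ℓ)) z<s (lemma ℓ) (from-yes (2 <? 41)) (from-yes (listed? 1 2))
      where
      lemma : ∀ l → 2 * suc (suc l) ≡ suc l * 2 + 2
      lemma = solve-∀
  cases : ∀ q → 0 < q → 2 * ℓ ≡ P * q + r → Available P r → Goal
  cases q 0<q 2ℓ≡ (inj₁ l) = from-spiral (spiral p q r ℓ 0<q (trans 2ℓ≡ (cong (_+ r) (*-comm P q))) P<41 l)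
  cases 1 _ 2ℓ≡ (inj₂ (_ , small)) = short (trans 2ℓ≡ (cong (_+ r) (*-identityʳ P))) small
  -- One zigzag is absorbed into the seed, and at least one remains.
  cases (suc (suc q)) _ 2ℓ≡ (inj₂ (l , _)) = from-spiral (spiral p (suc q) (P + r) ℓ z<s (trans 2ℓ≡ (lemma P q r)) P<41 l)
    where
    lemma : ∀ p q r → p * suc (suc q) + r ≡ suc q * p + (p + r)
    lemma = solve-∀

import Data.Integer.Properties as ℤₚ
open import Data.Integer.Base as ℤ using (ℤ; +_; -[1+_])

theorem5p4 : ∀ (ℓ p q : ℕ) (r : ℤ) → 0 < ℓ → 0 < p → 0 < q →
    + (2 * ℓ) ≡ + (p * q) ℤ.+ r →
    + p ℤ.≤ + 2 ℤ.* r → r ℤ.≤ + 20 →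
    ∀ (S : List (Group.Carrier (Dihedral (1 + 4 * ℓ)))) →
    Unique S → Group.ε (Dihedral (1 + 4 * ℓ)) ∉ S → length S ≡ 8 * ℓ →
    ∀ (x : Group.Carrier (Dihedral (1 + 4 * ℓ))) →
    x ≢ Group.ε (Dihedral (1 + 4 * ℓ)) → x ∉ S →
    SameOrder (Dihedral (1 + 4 * ℓ)) x
    (u (1 + 4 * ℓ) ^[ Dihedral (1 + 4 * ℓ) ] (2 * ℓ ∸ p + 1)) →
    HasSequencing (Dihedral (1 + 4 * ℓ)) S
theorem5p4 ℓ p q (+ r) 0<ℓ 0<p 0<q 2ℓ≡ p≤ r≤ S uS ε∉ len x x≢ε x∉ same =
  let a , g≡ , av = avoidable ℓ p q r 0<ℓ 0<p 0<q (ℤₚ.+-injective 2ℓ≡)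
        (ℤₚ.drop‿+≤+ (subst (+ p ℤ.≤_) (sym (ℤₚ.pos-* 2 r)) p≤)) (ℤₚ.drop‿+≤+ r≤)
  in SameOrders.avoidable⇒sequencing ℓ a (2 * ℓ ∸ p + 1) av x≢ε g≡ same S uS ε∉ x∉ len
-- A negative `r` makes 2r negative, so it cannot bound the natural number `p` from above.
theorem5p4 ℓ p q -[1+ r ] 0<ℓ 0<p 0<q 2ℓ≡ () r≤
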